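{- Let $G$ be a 3-connected graph that contains a non-degenerate vertex-2-edge-separator $(c,e_1,e_2)$. (a) If $c$ is incident to an edge $e_0\in E(G)$ such that $G-e_0-e_1-e_2$ is disconnected with components $C_1$ and $C_2$, let $G_1$ (resp. $G_2$) be the graph constructed by adding a new vertex $x_1$ (resp. $x_2$) and the edges $u_ix_1$ (resp. $v_ix_2$) for $i\in\{0,1,2\}$, where $u_i$ (resp. $v_i$) denotes the endvertex of $e_i$ in $C_1$ (resp. $C_2$). (b) Otherwise, there are exactly two components $C_1$ and $C_2$ of $G-e_1-e_2-c$; let $G_1$ (resp. $G_2$) be the graph constructed from $G[V(C_1)\cup\{c\}]$ (resp. $G[V(C_2)\cup\{c\}]$) by adding a new vertex $x_1$ (resp. $x_2$) and the edges $u_1x_1,u_2x_1,cx_1$ (resp. $v_1x_2,v_2x_2,cx_2$), where $u_i$ (resp. $v_i$) is the endvertex of $e_i$ in $C_1$ (resp. $C_2$). If $G$ is critical 2.5-connected, then $G_1$ and $G_2$ are critical 2.5-connected, 3-connected graphs of smaller order than $G$.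
   Context: Graphs are finite, may have parallel edges, and have no loops. A graph is biconnected if it is connected and for every triple of distinct vertices $u,v,w$ there is a $u$-$v$-path avoiding $w$. For a biconnected graph $G$ that is not a triangle, $(c,e)\in V(G)\times E(G)$ is a vertex-edge-separator if $G-e-c$ is disconnected; $G$ is 2.5-connected if it is biconnected and has no vertex-edge-separator. A vertex-2-edge-separator of a biconnected graph $G$ is a triple $(c,e_1,e_2)\in V(G)\times E(G)^2$ with $G-e_1-e_2-c$ disconnected. $G$ is critical 2.5-connected if it is 2.5-connected and $G-e$ is not 2.5-connected for every $e\in E(G)$. If $u\in V(G)$ has degree $3$ with incident edges $e_0,e_1,e_2$ and $c$ is the other end of $e_0$, then $(c,e_1,e_2)$ is a degenerate vertex-2-edge-separator; a vertex-2-edge-separator is non-degenerate if it is not of this form. -}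

module Defs where

open import Data.Nat using (ℕ; zero; suc; _≤_; _<_)
open import Data.Fin using (Fin; punchIn; _≟_)
open import Data.Product using (Σ; ∃; _×_; _,_; proj₁; proj₂)
open import Data.Sum using (_⊎_; inj₁; inj₂)
open import Data.Maybe using (Maybe; just; nothing)
open import Data.Bool using (Bool; true; false)
open import Data.Unit using (⊤)
open import Data.List using (length; filter; allFin)
open import Relation.Binary.PropositionalEquality using (_≡_; _≢_)
open import Relation.Nullary using (¬_; Dec)
open import Relation.Nullary.Decidable using (_⊎-dec_)
open import Function using (_∘_)

-- Finite loopless multigraphs: vertices Fin n, edges Fin m, each edge
-- has an (unordered) pair of distinct ends, stored as an ordered pair.

record Graph : Set where
  constructor graph
  field
    n        : ℕ
    m        : ℕ
    ends     : Fin m → Fin n × Fin n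
    loopless : ∀ e → proj₁ (ends e) ≢ proj₂ (ends e)

open Graph public

Vtx : Graph → Set
Vtx G = Fin (n G)

Edge : Graph → Set
Edge G = Fin (m G)

UEq : {A : Set} → A × A → A × A → Set
UEq (x , y) (x' , y') = (x ≡ x' × y ≡ y') ⊎ (x ≡ y' × y ≡ x')

IsEnd : (G : Graph) → Edge G → Vtx G → Set
IsEnd G e v = proj₁ (ends G e) ≡ v ⊎ proj₂ (ends G e) ≡ v

isEnd? : (G : Graph) (e : Edge G) (v : Vtx G) → Dec (IsEnd G e v)
isEnd? G e v = (proj₁ (ends G e) ≟ v) ⊎-dec (proj₂ (ends G e) ≟ v)

Joins : (G : Graph) → Edge G → Vtx G → Vtx G → Set
Joins G e u w = UEq (ends G e) (u , w)

deg : (G : Graph) → Vtx G → ℕ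
deg G v = length (filter (λ e → isEnd? G e v) (allFin (m G)))

-- Walks in the subgraph of G consisting of the vertices satisfying KV
-- and the edges satisfying KE (edges are only traversed between kept
-- vertices).  "G - X - F" = KV v := v ∉ X, KE e := e ∉ F.

data Walk (G : Graph) (KV : Vtx G → Set) (KE : Edge G → Set)
     : Vtx G → Vtx G → Set where
  nil  : ∀ {u} → KV u → Walk G KV KE u u
  cons : ∀ {u w v} (e : Edge G) → KE e → KV u → Joins G e u w →
         Walk G KV KE w v → Walk G KV KE u v

AllV : (G : Graph) → Vtx G → Set
AllV G _ = ⊤

AllE : (G : Graph) → Edge G → Set
AllE G _ = ⊤

Connected : (G : Graph) → (Vtx G → Set) → (Edge G → Set) → Set
Connected G KV KE = ∀ u v → KV u → KV v → Walk G KV KE u v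

IsComponent : (G : Graph) → (Vtx G → Set) → (Edge G → Set) → (Vtx G → Set) → Set
IsComponent G KV KE C =
  (∃ λ v → C v) ×
  (∀ v → C v → KV v) ×
  (∀ u v → C u → C v → Walk G KV KE u v) ×
  (∀ u v → C u → Walk G KV KE u v → C v)

-- the components of the subgraph (KV, KE) are exactly C₁ and C₂
-- (C₁, C₂ will always be given disjoint)
TwoComponents : (G : Graph) → (Vtx G → Set) → (Edge G → Set) →
                (Vtx G → Set) → (Vtx G → Set) → Set
TwoComponents G KV KE C₁ C₂ =
  IsComponent G KV KE C₁ × IsComponent G KV KE C₂ ×
  (∀ v → KV v → C₁ v ⊎ C₂ v)

Biconnected : Graph → Set
Biconnected G =
  Connected G (AllV G) (AllE G) ×
  (∀ u v w → u ≢ v → u ≢ w → v ≢ w →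
     Walk G (λ x → x ≢ w) (AllE G) u v)

IsTriangle : Graph → Set
IsTriangle G = n G ≡ 3 × m G ≡ 3 × (∀ u v → u ≢ v → ∃ λ e → Joins G e u v)

VertexEdgeSeparator : (G : Graph) → Vtx G → Edge G → Set
VertexEdgeSeparator G c e = ¬ Connected G (λ v → v ≢ c) (λ f → f ≢ e)

TwoHalfConnected : Graph → Set
TwoHalfConnected G =
  Biconnected G × (¬ IsTriangle G → ∀ c e → ¬ VertexEdgeSeparator G c e)

deleteEdge : (G : Graph) → Edge G → Graph
deleteEdge (graph n zero ends ll) ()
deleteEdge (graph n (suc m) ends ll) e = graph n m (ends ∘ punchIn e) (ll ∘ punchIn e)

CriticalTwoHalfConnected : Graph → Set
CriticalTwoHalfConnected G =
  TwoHalfConnected G × (∀ e → ¬ TwoHalfConnected (deleteEdge G e))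

ThreeConnected : Graph → Set
ThreeConnected G =
  4 ≤ n G × (∀ s t → Connected G (λ v → v ≢ s × v ≢ t) (AllE G))

Vertex2EdgeSeparator : (G : Graph) → Vtx G → Edge G → Edge G → Set
Vertex2EdgeSeparator G c e₁ e₂ =
  Biconnected G × ¬ Connected G (λ v → v ≢ c) (λ f → f ≢ e₁ × f ≢ e₂)

Degenerate : (G : Graph) → Vtx G → Edge G → Edge G → Set
Degenerate G c e₁ e₂ =
  Σ (Vtx G) λ u → Σ (Edge G) λ e₀ →
    deg G u ≡ 3 × e₀ ≢ e₁ × e₀ ≢ e₂ × e₁ ≢ e₂ ×
    IsEnd G e₀ u × IsEnd G e₁ u × IsEnd G e₂ u × Joins G e₀ u c

NonDegenerateV2ESep : (G : Graph) → Vtx G → Edge G → Edge G → Set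
NonDegenerateV2ESep G c e₁ e₂ =
  Vertex2EdgeSeparator G c e₁ e₂ × ¬ Degenerate G c e₁ e₂

-- Construction: H is (isomorphic to) the graph with vertex set
-- {v | KV v} plus one new vertex x, edge set {e | KE e} (with the same
-- ends) plus three new edges joining x to a 0, a 1, a 2.
-- φ maps vertices of H to vertices of G (nothing = the new vertex x),
-- ψ maps edges of H to edges of G (inj₁) or to the new edges (inj₂ i).

attach : {A : Set} → A → A → A → Fin 3 → A
attach a b c Fin.zero = a
attach a b c (Fin.suc Fin.zero) = b
attach a b c (Fin.suc (Fin.suc Fin.zero)) = c

mapPair : {A B : Set} → (A → B) → A × A → B × B
mapPair f (x , y) = f x , f y

IsAttachGraph : (G : Graph) → (Vtx G → Set) → (Edge G → Set) →
                (Fin 3 → Vtx G) → Graph → Set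
IsAttachGraph G KV KE a H =
  Σ (Vtx H → Maybe (Vtx G)) λ φ →
  Σ (Edge H → Edge G ⊎ Fin 3) λ ψ →
    (∀ x y → φ x ≡ φ y → x ≡ y) ×
    (∀ x v → φ x ≡ just v → KV v) ×
    (∀ v → KV v → ∃ λ x → φ x ≡ just v) ×
    (∃ λ x → φ x ≡ nothing) ×
    (∀ f g → ψ f ≡ ψ g → f ≡ g) ×
    (∀ f e → ψ f ≡ inj₁ e → KE e) ×
    (∀ e → KE e → ∃ λ f → ψ f ≡ inj₁ e) ×
    (∀ i → ∃ λ f → ψ f ≡ inj₂ i) ×
    (∀ f e → ψ f ≡ inj₁ e →
       UEq (mapPair φ (ends H f)) (mapPair just (ends G e))) ×
    (∀ f i → ψ f ≡ inj₂ i →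
       UEq (mapPair φ (ends H f)) (nothing , just (a i)))

InducedE : (G : Graph) → (Vtx G → Set) → (Edge G → Set) → Edge G → Set
InducedE G KV P e = KV (proj₁ (ends G e)) × KV (proj₂ (ends G e)) × P e

GoodPart : Graph → Graph → Set
GoodPart G H = CriticalTwoHalfConnected H × ThreeConnected H × n H < n G

{-# OPTIONS --safe #-}

-- Disconnected subgraphs are witnessed by cuts, i.e. 2-colourings of the vertices that are
-- constant along kept edges. A 3-connected graph G on at least 4 vertices stays connected
-- after deleting a vertex and an edge, so G is critical iff every edge e lies in some
-- vertex-2-edge-separator (z, e, f); this also rules out parallel edges, and hence
-- non-degeneracy makes the ends of e₁ and e₂ on either side distinct.
-- Each G_i is G with one side contracted to the new vertex x_i. A cut of G_i by at most two
-- vertices pulls back to such a cut of G, unless x_i is removed, where the minority among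
-- the three attachment vertices is cut off in G by at most two vertices. For criticality,
-- a separator (z, e, f) of G with e in the kept side K gives one of G_i: (x_i, e, f) if z ∉ K;
-- (z, e, f) if z and f are in K, since the contracted side is then not cut; and if f is not
-- in K, giving x_i the majority colour of its neighbours leaves only e and one edge at x_i.

module Submission where

open import Defs
open import Data.Nat as ℕ using (ℕ; zero; suc; s≤s; z≤n)
import Data.Nat.Properties as ℕ
open import Data.Fin using (Fin; zero; suc; _≟_; inject≤; punchIn; punchOut)
open import Data.Fin.Properties using (any?; inject≤-injective; pigeonhole; injective⇒≤; punchIn-punchOut; punchIn-injective; punchInᵢ≢i; <⇒≢)
open import Data.Bool using (Bool; true; false; not; if_then_else_)
import Data.Bool.Properties as Bool
open import Data.Empty using (⊥; ⊥-elim)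
open import Data.Unit using (tt)
open import Data.List using (List; []; _∷_; length; filter; allFin; _++_)
open import Data.List.Properties using (length-++)
open import Data.List.Membership.Propositional using (_∈_)
open import Data.List.Membership.Propositional.Properties using (∈-allFin; ∈-∃++; ∈-++⁺ˡ; ∈-++⁺ʳ; ∈-++⁻; ∈-filter⁺; ∈-filter⁻)
open import Data.List.Relation.Unary.All as All using ([]; _∷_)
open import Data.List.Relation.Unary.AllPairs using ([]; _∷_)
open import Data.List.Relation.Unary.Any using (here; there)
open import Data.List.Relation.Unary.Unique.Propositional using (Unique)
import Data.List.Relation.Unary.Unique.Propositional.Properties as Unique
open import Data.Maybe using (Maybe; just; nothing; maybe′)
open import Data.Maybe.Properties using (just-injective)
open import Data.Product using (∃; _×_; _,_; proj₁; proj₂)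
open import Data.Sum using (_⊎_; inj₁; inj₂; [_,_])
open import Data.Sum.Properties using (inj₁-injective; inj₂-injective)
open import Function using (_∘_; id)
open import Relation.Binary.PropositionalEquality using (_≡_; _≢_; refl; sym; trans; cong; subst; ≢-sym)
open import Relation.Nullary using (¬_; Dec; yes; no; does; contradiction)
open import Relation.Nullary.Decidable using (_×-dec_; _⊎-dec_; ¬?; decidable-stable; dec-true; dec-false)
open import Relation.Unary using (Decidable)

-- Booleans, pigeonhole and ends of edges

two-valued : ∀ {x y z : Bool} → x ≢ z → y ≢ z → x ≡ y
two-valued x≢z y≢z = trans (Bool.¬-not x≢z) (sym (Bool.¬-not y≢z))

-- If `f` hit every `g i`, a choice of preimages would map `Fin l` to the smaller `Fin k`, and a
-- collision there contradicts injectivity of `g`. It serves to find a vertex different from a few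
-- given ones.
avoiding : ∀ {k l n} → k ℕ.< l → (g : Fin l → Fin n) → (∀ {i j} → g i ≡ g j → i ≡ j) →
  (f : Fin k → Fin n) → ∃ λ i → ∀ j → g i ≢ f j
avoiding k<l g g-inj f with any? (λ i → ¬? (any? λ j → g i ≟ f j))
... | yes (i , miss) = i , λ j eq → miss (j , eq)
... | no ¬miss =
  let hit = λ i → decidable-stable (any? λ j → g i ≟ f j) (λ q → ¬miss (i , q))
      i , j , i<j , eq = pigeonhole k<l (proj₁ ∘ hit)
  in contradiction (g-inj (trans (proj₂ (hit i)) (trans (cong f eq) (sym (proj₂ (hit j)))))) (<⇒≢ i<j)

Joins-sym : ∀ {G e u w} → Joins G e u w → Joins G e w u
Joins-sym (inj₁ (p , q)) = inj₂ (p , q)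
Joins-sym (inj₂ (p , q)) = inj₁ (p , q)

Joins-ends : ∀ G e → Joins G e (proj₁ (ends G e)) (proj₂ (ends G e))
Joins-ends G e = inj₁ (refl , refl)

Joins-unique : ∀ {G e u w u′ w′} → Joins G e u w → Joins G e u′ w′ → UEq (u , w) (u′ , w′)
Joins-unique (inj₁ (refl , refl)) k = k
Joins-unique (inj₂ (refl , refl)) (inj₁ (p , q)) = inj₂ (q , p)
Joins-unique (inj₂ (refl , refl)) (inj₂ (p , q)) = inj₁ (q , p)

IsEnd-Joins : ∀ {G e x u w} → IsEnd G e x → Joins G e u w → u ≡ x ⊎ w ≡ x
IsEnd-Joins (inj₁ refl) (inj₁ (p , q)) = inj₁ (sym p)
IsEnd-Joins (inj₁ refl) (inj₂ (p , q)) = inj₂ (sym p)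
IsEnd-Joins (inj₂ refl) (inj₁ (p , q)) = inj₂ (sym q)
IsEnd-Joins (inj₂ refl) (inj₂ (p , q)) = inj₁ (sym q)

Joins⇒IsEnd : ∀ {G e u w} → Joins G e u w → IsEnd G e u
Joins⇒IsEnd (inj₁ (p , q)) = inj₁ p
Joins⇒IsEnd (inj₂ (p , q)) = inj₂ q

IsEnd⇒Joins : ∀ {G e u w} → u ≢ w → IsEnd G e u → IsEnd G e w → Joins G e u w
IsEnd⇒Joins u≢w (inj₁ p) (inj₁ q) = contradiction (trans (sym p) q) u≢w
IsEnd⇒Joins u≢w (inj₁ p) (inj₂ q) = inj₁ (p , q)
IsEnd⇒Joins u≢w (inj₂ p) (inj₁ q) = inj₂ (q , p)
IsEnd⇒Joins u≢w (inj₂ p) (inj₂ q) = contradiction (trans (sym p) q) u≢w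

Joins⇒≢ : ∀ {G e u w} → Joins G e u w → u ≢ w
Joins⇒≢ {G} {e} (inj₁ (refl , refl)) = loopless G e
Joins⇒≢ {G} {e} (inj₂ (refl , refl)) = loopless G e ∘ sym

other-end : ∀ G {e x} → IsEnd G e x → ∃ λ y → Joins G e x y
other-end G (inj₁ p) = _ , inj₁ (p , refl)
other-end G (inj₂ p) = _ , inj₂ (refl , p)

UEq? : ∀ {n} (p q : Fin n × Fin n) → Dec (UEq p q)
UEq? (x , y) (x′ , y′) = ((x ≟ x′) ×-dec (y ≟ y′)) ⊎-dec ((x ≟ y′) ×-dec (y ≟ x′))

-- Connectivity by walks and by two-colourings

-- T also colours removed vertices; these colours are irrelevant.

Closed : (G : Graph) → (Vtx G → Set) → (Edge G → Set) → (Vtx G → Bool) → Set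
Closed G KV KE T = ∀ {e u w} → Joins G e u w → KE e → KV u → KV w → T u ≡ T w

Constant : (G : Graph) → (Vtx G → Set) → (Vtx G → Bool) → Set
Constant G KV T = ∀ {u v} → KV u → KV v → T u ≡ T v

Uncut : (G : Graph) → (Vtx G → Set) → (Edge G → Set) → Set
Uncut G KV KE = ∀ T → Closed G KV KE T → Constant G KV T

module _ {G : Graph} {KV : Vtx G → Set} {KE : Edge G → Set} where

  start : ∀ {u v} → Walk G KV KE u v → KV u
  start (nil k) = k
  start (cons _ _ k _ _) = k

  edge-walk : ∀ {e u w} → KE e → KV u → KV w → Joins G e u w → Walk G KV KE u w
  edge-walk {e} ke ku kw j = cons e ke ku j (nil kw)

  _▷_ : ∀ {u v w} → Walk G KV KE u v → Walk G KV KE v w → Walk G KV KE u w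
  nil _ ▷ q = q
  cons e ke ku j p ▷ q = cons e ke ku j (p ▷ q)

  reverse : ∀ {u v} → Walk G KV KE u v → Walk G KV KE v u
  reverse (nil k) = nil k
  reverse (cons e ke ku j p) = reverse p ▷ edge-walk ke (start p) ku (Joins-sym {G} j)

  module _ {A : Set} (ℓ : Vtx G → A)
    (closed : ∀ {e u w} → Joins G e u w → KE e → KV u → KV w → ℓ u ≡ ℓ w) where

    walk-invariant : ∀ {u v} → Walk G KV KE u v → ℓ u ≡ ℓ v
    walk-invariant (nil _) = refl
    walk-invariant (cons e ke ku j p) = trans (closed j ke ku (start p)) (walk-invariant p)

  connected⇒uncut : Connected G KV KE → Uncut G KV KE
  connected⇒uncut conn T closed ku kv = walk-invariant T closed (conn _ _ ku kv)

  -- A union-find state after the edges in `es` have been processed: `walk` keeps every class within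
  -- a component, and `along` says that no processed kept edge joins two classes. Once all edges are
  -- processed, the classes are the components.
  record Labelling (es : List (Edge G)) : Set where
    field
      label : Vtx G → Vtx G
      walk  : ∀ {v} → KV v → Walk G KV KE v (label v)
      along : ∀ {e u w} → e ∈ es → Joins G e u w → KE e → KV u → KV w → label u ≡ label w

  module _ (KV? : Decidable KV) (KE? : Decidable KE) where

    -- A new edge that is kept together with its ends redirects the class of `p` to the label of
    -- `q`. The walk to the new label goes back from the old one to `p`, across the edge and on from
    -- `q`.
    label-along : ∀ es → Labelling es
    label-along [] = record { label = id ; walk = nil ; along = λ () }
    label-along (e ∷ es) with label-along es
    ... | L with KE? e ×-dec (KV? (proj₁ (ends G e)) ×-dec KV? (proj₂ (ends G e)))
    ... | no drop = record { label = label ; walk = walk ; along = along′ }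
      where
      open Labelling L
      along′ : ∀ {f u w} → f ∈ e ∷ es → Joins G f u w → KE f → KV u → KV w → label u ≡ label w
      along′ (here refl) (inj₁ (refl , refl)) kf ku kw = contradiction (kf , ku , kw) drop
      along′ (here refl) (inj₂ (refl , refl)) kf ku kw = contradiction (kf , kw , ku) drop
      along′ (there f∈) = along f∈
    ... | yes (ke , kp , kq) = record { label = merge ∘ label ; walk = λ kv → walk kv ▷ merge-walk (walk kv) ; along = along′ }
      where
      open Labelling L
      p q : Vtx G
      p = proj₁ (ends G e)
      q = proj₂ (ends G e)
      merge : Vtx G → Vtx G
      merge v with v ≟ label p
      ... | yes _ = label q
      ... | no  _ = v
      finish : ∀ {u v} → Walk G KV KE u v → KV v
      finish r = start (reverse r)
      merge-walk : ∀ {u v} → Walk G KV KE u v → Walk G KV KE v (merge v)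
      merge-walk {v = v} r with v ≟ label p
      ... | yes refl = reverse (walk kp) ▷ (edge-walk ke kp kq (Joins-ends G e) ▷ walk kq)
      ... | no  _    = nil (finish r)
      merge-pq : merge (label p) ≡ merge (label q)
      merge-pq with label p ≟ label p | label q ≟ label p
      ... | yes _ | yes _ = refl
      ... | yes _ | no  _ = refl
      ... | no  n | _     = contradiction refl n
      along′ : ∀ {f u w} → f ∈ e ∷ es → Joins G f u w → KE f → KV u → KV w → merge (label u) ≡ merge (label w)
      along′ (here refl) (inj₁ (refl , refl)) _ _ _ = merge-pq
      along′ (here refl) (inj₂ (refl , refl)) _ _ _ = sym merge-pq
      along′ (there f∈) j kf ku kw = cong merge (along f∈ j kf ku kw)

    labelling : Labelling (allFin (m G))
    labelling = label-along (allFin (m G))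

    open Labelling labelling

    same-label⇒walk : ∀ {u v} → KV u → KV v → label u ≡ label v → Walk G KV KE u v
    same-label⇒walk {u} ku kv eq = subst (Walk G KV KE u) eq (walk ku) ▷ reverse (walk kv)

    -- If `v` had another label than `u`, the indicator of the label class of `u` would be a cut
    -- between them.
    uncut⇒connected : Uncut G KV KE → Connected G KV KE
    uncut⇒connected uncut u v ku kv with label v ≟ label u
    ... | yes p = same-label⇒walk ku kv (sym p)
    ... | no ¬p = contradiction
      (trans (sym (dec-true (label u ≟ label u) refl)) (trans (uncut T closed ku kv) (dec-false (label v ≟ label u) ¬p))) λ ()
      where
      T : Vtx G → Bool
      T w = does (label w ≟ label u)
      closed : Closed G KV KE T
      closed j ke ku kw = cong (λ x → does (x ≟ label u)) (along (∈-allFin _) j ke ku kw)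

-- Counting incident edges

module _ {A : Set} where

  unique-⊆⇒length≤ : {xs ys : List A} → Unique xs → (∀ {x} → x ∈ xs → x ∈ ys) → length xs ℕ.≤ length ys
  unique-⊆⇒length≤ [] _ = z≤n
  unique-⊆⇒length≤ {x ∷ xs} (x∉xs ∷ uxs) sub with ∈-∃++ (sub (here refl))
  ... | as , bs , refl = ℕ.≤-trans (s≤s (unique-⊆⇒length≤ uxs sub′)) (ℕ.≤-reflexive eq)
    where
    sub′ : ∀ {y} → y ∈ xs → y ∈ as ++ bs
    sub′ y∈ with ∈-++⁻ as (sub (there y∈))
    ... | inj₁ y∈as = ∈-++⁺ˡ y∈as
    ... | inj₂ (here refl) = contradiction refl (All.lookup x∉xs y∈)
    ... | inj₂ (there y∈bs) = ∈-++⁺ʳ as y∈bs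
    eq : suc (length (as ++ bs)) ≡ length (as ++ x ∷ bs)
    eq = trans (cong suc (length-++ as)) (trans (sym (ℕ.+-suc (length as) (length bs))) (sym (length-++ as)))

-- The list of incident edges and the list of the three given edges contain each other and have no
-- repetitions, so each length bounds the other.
deg≡3 : ∀ G {v e₀ e₁ e₂} → e₀ ≢ e₁ → e₀ ≢ e₂ → e₁ ≢ e₂ →
  IsEnd G e₀ v → IsEnd G e₁ v → IsEnd G e₂ v →
  (∀ f → IsEnd G f v → f ∈ e₀ ∷ e₁ ∷ e₂ ∷ []) → deg G v ≡ 3
deg≡3 G {v} n₀₁ n₀₂ n₁₂ i₀ i₁ i₂ only = ℕ.≤-antisym
  (unique-⊆⇒length≤ (Unique.filter⁺ (λ e → isEnd? G e v) (Unique.allFin⁺ (m G)))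
    (λ f∈ → only _ (proj₂ (∈-filter⁻ (λ e → isEnd? G e v) {xs = allFin (m G)} f∈))))
  (unique-⊆⇒length≤ ((n₀₁ ∷ n₀₂ ∷ []) ∷ (n₁₂ ∷ []) ∷ [] ∷ [])
    λ { (here refl) → inc i₀ ; (there (here refl)) → inc i₁ ; (there (there (here refl))) → inc i₂ })
  where
  inc : ∀ {e} → IsEnd G e v → e ∈ filter (λ e → isEnd? G e v) (allFin (m G))
  inc = ∈-filter⁺ (λ e → isEnd? G e v) (∈-allFin _)

-- Three-connected graphs after removing a vertex and an edge

module _ {G : Graph} (three : ThreeConnected G) where

  uncut₂ : ∀ s t → Uncut G (λ v → v ≢ s × v ≢ t) (AllE G)
  uncut₂ s t = connected⇒uncut (proj₂ three s t)

  uncut₁ : ∀ c → Uncut G (_≢ c) (AllE G)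
  uncut₁ c T closed u≢c v≢c =
    uncut₂ c c T (λ j k p q → closed j k (proj₁ p) (proj₁ q)) (u≢c , u≢c) (v≢c , v≢c)

  fresh : ∀ x y z → ∃ λ (w : Vtx G) → w ≢ x × w ≢ y × w ≢ z
  fresh x y z with avoiding {k = 3} ℕ.≤-refl (λ i → inject≤ i (proj₁ three))
                     (inject≤-injective _ _ _ _) (attach x y z)
  ... | i , avoid = _ , avoid zero , avoid (suc zero) , avoid (suc (suc zero))

  -- The exempt edges join `p` and `q`. They vanish if `c` is one of these, and they do no harm if
  -- `p` and `q` have the same colour. Exempting a whole class of parallel edges is what
  -- `no-parallel` needs.
  uncut-modulo : ∀ c p q T →
    (∀ {e u w} → Joins G e u w → ¬ UEq (u , w) (p , q) → u ≢ c → w ≢ c → T u ≡ T w) →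
    Constant G (_≢ c) T
  uncut-modulo c p q T closed with p ≟ c | q ≟ c | T p Bool.≟ T q
  ... | yes refl | _ | _ = uncut₁ c T λ j _ u≢c w≢c →
    closed j (λ { (inj₁ (r , _)) → u≢c r ; (inj₂ (_ , r)) → w≢c r }) u≢c w≢c
  ... | no _ | yes refl | _ = uncut₁ c T λ j _ u≢c w≢c →
    closed j (λ { (inj₁ (_ , r)) → w≢c r ; (inj₂ (r , _)) → u≢c r }) u≢c w≢c
  ... | no _ | no _ | yes Tp≡Tq = uncut₁ c T closed′
    where
    closed′ : Closed G (_≢ c) (AllE G) T
    closed′ {u = u} {w} j _ u≢c w≢c with UEq? (u , w) (p , q)
    ... | yes (inj₁ (refl , refl)) = Tp≡Tq
    ... | yes (inj₂ (refl , refl)) = sym Tp≡Tq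
    ... | no ¬r = closed j ¬r u≢c w≢c
  ... | no p≢c | no q≢c | no Tp≢Tq = ⊥-elim split
    where
    -- a third vertex lies on the side of p or of q, which can then be removed
    split : ⊥
    split with fresh c p q
    ... | w , w≢c , w≢p , w≢q with T w Bool.≟ T p
    ... | yes Tw≡Tp = Tp≢Tq (trans (sym Tw≡Tp) (uncut₂ c p T
            (λ j _ (u≢c , u≢p) (v≢c , v≢p) →
              closed j (λ { (inj₁ (r , _)) → u≢p r ; (inj₂ (_ , r)) → v≢p r }) u≢c v≢c)
            (w≢c , w≢p) (q≢c , λ q≡p → Tp≢Tq (cong T (sym q≡p)))))
    ... | no Tw≢Tp = Tw≢Tp (uncut₂ c q T
            (λ j _ (u≢c , u≢q) (v≢c , v≢q) →
              closed j (λ { (inj₁ (_ , r)) → v≢q r ; (inj₂ (r , _)) → u≢q r }) u≢c v≢c)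
            (w≢c , w≢q) (p≢c , λ p≡q → Tp≢Tq (cong T p≡q)))

  uncut₁₁ : ∀ c e → Uncut G (_≢ c) (_≢ e)
  uncut₁₁ c e T closed = uncut-modulo c (proj₁ (ends G e)) (proj₂ (ends G e)) T
    λ j ¬r → closed j λ { refl → ¬r (Joins-unique {G} j (Joins-ends G e)) }

  -- Two vertices can be compared after removing an unrelated third vertex `w`.
  uncut-minus-edge : ∀ e T → Closed G (AllV G) (_≢ e) T → ∀ u v → T u ≡ T v
  uncut-minus-edge e T closed u v with fresh u v v
  ... | w , w≢u , w≢v , _ = uncut₁₁ w e T (λ j k _ _ → closed j k tt tt) (≢-sym w≢u) (≢-sym w≢v)

  three⇒twoHalf : TwoHalfConnected G
  three⇒twoHalf =
    ( uncut⇒connected (λ _ → yes tt) (λ _ → yes tt)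
        (λ T closed {u} {v} _ _ → minus-any T closed u v)
    , λ u v w u≢v u≢w v≢w → uncut⇒connected (λ x → ¬? (x ≟ w)) (λ _ → yes tt) (uncut₁ w) u v u≢w v≢w )
    , λ _ c e ¬conn → ¬conn (uncut⇒connected (λ x → ¬? (x ≟ c)) (λ f → ¬? (f ≟ e)) (uncut₁₁ c e))
    where
    minus-any : ∀ T → Closed G (AllV G) (AllE G) T → ∀ u v → T u ≡ T v
    minus-any T closed u v with fresh u v v
    ... | w , w≢u , w≢v , _ = uncut₁ w T (λ j k _ _ → closed j k tt tt) (≢-sym w≢u) (≢-sym w≢v)

-- Criticality in terms of separators

-- This excludes separators `(z , e , f)` through `e`. It stands in for 2.5-connectivity of `G`
-- minus `e` and names edges as in `G`, without the renumbering done by `deleteEdge`.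
V2EUncut : (G : Graph) → Edge G → Set
V2EUncut G e = ∀ z f → f ≢ e → Uncut G (_≢ z) (λ h → h ≢ e × h ≢ f)

-- Biconnectivity without `e` follows from 3-connectivity; a vertex-edge-separator there would be a
-- separator through `e` in `G`.
V2EUncut⇒twoHalf : ∀ G → ThreeConnected G → ∀ e → V2EUncut G e → TwoHalfConnected (deleteEdge G e)
V2EUncut⇒twoHalf (graph _ zero _ _) _ ()
V2EUncut⇒twoHalf G@(graph n (suc m) en ll) three e uncut =
  ( uncut⇒connected (λ _ → yes tt) (λ _ → yes tt) (λ T closed {u} {v} _ _ →
      uncut-minus-edge three e T (λ {f} j f≢e ku kw → restore f≢e j λ f′ _ j′ → closed {f′} j′ tt ku kw) u v)
  , λ u v w u≢v u≢w v≢w → uncut⇒connected (λ x → ¬? (x ≟ w)) (λ _ → yes tt)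
      (λ T closed → uncut₁₁ three w e T λ {f} j f≢e ku kw → restore f≢e j λ f′ _ j′ → closed {f′} j′ tt ku kw)
      u v u≢w v≢w )
  , λ _ c f ¬conn → ¬conn (uncut⇒connected (λ x → ¬? (x ≟ c)) (λ h → ¬? (h ≟ f)) λ T closed →
      uncut c (punchIn e f) (punchInᵢ≢i e f) T λ {h} j (h≢e , h≢f) ku kw →
        restore h≢e j λ h′ eq j′ → closed {h′} j′ (λ h′≡f → h≢f (trans (sym eq) (cong (punchIn e) h′≡f))) ku kw)
  where
  -- An edge of `G` other than `e` is handed on with its index in the smaller graph.
  restore : ∀ {f u w} {A : Set} → f ≢ e → Joins G f u w →
    (∀ f′ → punchIn e f′ ≡ f → Joins (deleteEdge G e) f′ u w → A) → A
  restore {f} {u} {w} f≢e j k = k (punchOut (≢-sym f≢e)) eq (subst (λ h → Joins G h u w) (sym eq) j)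
    where
    eq : punchIn e (punchOut (≢-sym f≢e)) ≡ f
    eq = punchIn-punchOut (≢-sym f≢e)

twoHalf⇒V2EUncut : ∀ G → 4 ℕ.≤ n G → ∀ e → TwoHalfConnected (deleteEdge G e) → V2EUncut G e
twoHalf⇒V2EUncut (graph _ zero _ _) _ ()
twoHalf⇒V2EUncut G@(graph n (suc m) en ll) 4≤n e (_ , noSep) z f f≢e T closed {u} {v} u≢z v≢z =
  decidable-stable (T u Bool.≟ T v) λ Tu≢Tv →
    noSep ¬tri z (punchOut (≢-sym f≢e)) λ conn → Tu≢Tv (connected⇒uncut conn T
      (λ {g} j g≢f ku kw → closed {punchIn e g} j
        (punchInᵢ≢i e g , λ q → g≢f (punchIn-injective e _ _ (trans q (sym (punchIn-punchOut (≢-sym f≢e)))))) ku kw)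
      u≢z v≢z)
  where
  -- The definition exempts triangles from the condition on separators; order at least four rules
  -- this case out.
  ¬tri : ¬ IsTriangle (deleteEdge G e)
  ¬tri (n≡3 , _) with subst (4 ℕ.≤_) n≡3 4≤n
  ... | s≤s (s≤s (s≤s ()))

Critical : Graph → Set
Critical G = ∀ e → ¬ V2EUncut G e

module _ {G : Graph} (three : ThreeConnected G) (crit : Critical G) where

  -- A parallel edge `e′` would keep `e` out of every separator. If `e′` is the other removed edge,
  -- `uncut-modulo` applies to their common ends; otherwise `e′` links the ends of `e` in its place.
  no-parallel : ∀ {e e′ u w} → Joins G e u w → Joins G e′ u w → e ≡ e′
  no-parallel {e} {e′} {u} {w} j j′ with e ≟ e′
  ... | yes eq = eq
  ... | no e≢e′ = ⊥-elim (crit e uncut)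
    where
    uncut : V2EUncut G e
    uncut z f f≢e T closed with f ≟ e′
    ... | yes refl = uncut-modulo three z u w T λ k ¬r → closed k
      ( (λ { refl → ¬r (Joins-unique {G} k j) }) , (λ { refl → ¬r (Joins-unique {G} k j′) }) )
    ... | no f≢e′ = uncut₁₁ three z f T closed′
      where
      closed′ : Closed G (_≢ z) (_≢ f) T
      closed′ {h} k h≢f x≢z y≢z with h ≟ e
      ... | no h≢e = closed k (h≢e , h≢f) x≢z y≢z
      ... | yes refl with Joins-unique {G} k j
      ... | inj₁ (refl , refl) = closed {e′} j′ (≢-sym e≢e′ , ≢-sym f≢e′) x≢z y≢z
      ... | inj₂ (refl , refl) = sym (closed {e′} j′ (≢-sym e≢e′ , ≢-sym f≢e′) y≢z x≢z)

-- Triples of colours and unordered pairs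

-- Two of three colours agree; `k` is the remaining index, whose colour is left open.
majority : (g : Fin 3 → Bool) → ∃ λ β → ∃ λ k → ∀ i → i ≢ k → g i ≡ β
majority g with g zero Bool.≟ g (suc zero) | g zero Bool.≟ g (suc (suc zero))
... | yes p | _ = g zero , suc (suc zero) ,
  λ { zero _ → refl ; (suc zero) _ → sym p ; (suc (suc zero)) n → contradiction refl n }
... | no _ | yes q = g zero , suc zero ,
  λ { zero _ → refl ; (suc zero) n → contradiction refl n ; (suc (suc zero)) _ → sym q }
... | no p | no q = g (suc zero) , zero ,
  λ { zero n → contradiction refl n ; (suc zero) _ → refl ; (suc (suc zero)) _ → two-valued (≢-sym q) (≢-sym p) }

others : (i : Fin 3) → ∃ λ j → ∃ λ k → j ≢ i × k ≢ i × j ≢ k × (∀ l → l ≢ i → l ≢ j → l ≡ k)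
others zero = suc zero , suc (suc zero) , (λ ()) , (λ ()) , (λ ()) ,
  λ { zero n _ → contradiction refl n ; (suc zero) _ n → contradiction refl n ; (suc (suc zero)) _ _ → refl }
others (suc zero) = zero , suc (suc zero) , (λ ()) , (λ ()) , (λ ()) ,
  λ { zero _ n → contradiction refl n ; (suc zero) n _ → contradiction refl n ; (suc (suc zero)) _ _ → refl }
others (suc (suc zero)) = zero , suc zero , (λ ()) , (λ ()) , (λ ()) ,
  λ { zero _ n → contradiction refl n ; (suc zero) _ _ → refl ; (suc (suc zero)) n _ → contradiction refl n }

UEq-trans : ∀ {A : Set} {p q r : A × A} → UEq p q → UEq q r → UEq p r
UEq-trans (inj₁ (refl , refl)) k = k
UEq-trans (inj₂ (refl , refl)) (inj₁ (p , q)) = inj₂ (q , p)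
UEq-trans (inj₂ (refl , refl)) (inj₂ (p , q)) = inj₁ (q , p)

UEq-sym : ∀ {A : Set} {p q : A × A} → UEq p q → UEq q p
UEq-sym (inj₁ (p , q)) = inj₁ (sym p , sym q)
UEq-sym (inj₂ (p , q)) = inj₂ (sym q , sym p)

UEq-map : ∀ {A B : Set} (f : A → B) {p q : A × A} → UEq p q → UEq (mapPair f p) (mapPair f q)
UEq-map f (inj₁ (p , q)) = inj₁ (cong f p , cong f q)
UEq-map f (inj₂ (p , q)) = inj₂ (cong f p , cong f q)

UEq-unmap : ∀ {A B : Set} {f : A → B} → (∀ x y → f x ≡ f y → x ≡ y) →
  {p q : A × A} → UEq (mapPair f p) (mapPair f q) → UEq p q
UEq-unmap inj (inj₁ (p , q)) = inj₁ (inj _ _ p , inj _ _ q)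
UEq-unmap inj (inj₂ (p , q)) = inj₂ (inj _ _ p , inj _ _ q)

-- Contracting one side to a new vertex

-- What is needed of the vertices kept in a part, in order that the part with a new
-- vertex x attached to a 0, a 1, a 2 inherits connectivity and criticality from G.
-- The new vertex plays the role of the contracted complement of K; `linked` says
-- that this complement is connected enough, even after removing a vertex z of K.
record Side (G : Graph) (K : Vtx G → Set) (a : Fin 3 → Vtx G) : Set where
  field
    K?        : Decidable K
    attached  : ∀ i → K (a i)
    distinct  : ∀ {i j} → a i ≡ a j → i ≡ j
    boundary  : ∀ {e u w} → Joins G e u w → K u → ¬ K w → ∃ λ i → a i ≡ u
    uncut-minus : ∀ t → Uncut G (λ v → K v × v ≢ t) (AllE G)
    linked    : ∀ {z} → K z → ∀ (T : Vtx G → Bool) →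
      (∀ {e u w} → Joins G e u w → ¬ (K u × K w) → u ≢ z → w ≢ z → T u ≡ T w) →
      ∀ i j → a i ≢ z → a j ≢ z → T (a i) ≡ T (a j)
    out₁ out₂ : Vtx G
    out₁∉     : ¬ K out₁
    out₂∉     : ¬ K out₂
    out-distinct : out₁ ≢ out₂

-- `KE-all` makes `H` minus its new vertex a copy of the subgraph of `G` induced by `K`, in both
-- constructions of the theorem.
module Attach {G : Graph} {K : Vtx G → Set} {KE : Edge G → Set} {a : Fin 3 → Vtx G} {H : Graph}
  (three : ThreeConnected G) (crit : Critical G) (side : Side G K a)
  (KE-all : ∀ {e u w} → Joins G e u w → K u → K w → KE e)
  (attach-graph : IsAttachGraph G K KE a H) where

  open Side side

  φ : Vtx H → Maybe (Vtx G)
  φ = proj₁ attach-graph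
  ψ : Edge H → Edge G ⊎ Fin 3
  ψ = proj₁ (proj₂ attach-graph)

  private
    Facts : Set
    Facts =
      (∀ x y → φ x ≡ φ y → x ≡ y) ×
      (∀ x v → φ x ≡ just v → K v) ×
      (∀ v → K v → ∃ λ x → φ x ≡ just v) ×
      (∃ λ x → φ x ≡ nothing) ×
      (∀ f g → ψ f ≡ ψ g → f ≡ g) ×
      (∀ f e → ψ f ≡ inj₁ e → KE e) ×
      (∀ e → KE e → ∃ λ f → ψ f ≡ inj₁ e) ×
      (∀ i → ∃ λ f → ψ f ≡ inj₂ i) ×
      (∀ f e → ψ f ≡ inj₁ e → UEq (mapPair φ (ends H f)) (mapPair just (ends G e))) ×
      (∀ f i → ψ f ≡ inj₂ i → UEq (mapPair φ (ends H f)) (nothing , just (a i)))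
    facts : Facts
    facts = proj₂ (proj₂ attach-graph)

  φ-injective : ∀ x y → φ x ≡ φ y → x ≡ y
  φ-injective = let (p , _) = facts in p
  φ-K : ∀ x v → φ x ≡ just v → K v
  φ-K = let (_ , p , _) = facts in p
  φ-onto : ∀ v → K v → ∃ λ x → φ x ≡ just v
  φ-onto = let (_ , _ , p , _) = facts in p
  ∞ : Vtx H
  ∞ = let (_ , _ , _ , p , _) = facts in proj₁ p
  φ-∞ : φ ∞ ≡ nothing
  φ-∞ = let (_ , _ , _ , p , _) = facts in proj₂ p
  ψ-injective : ∀ f g → ψ f ≡ ψ g → f ≡ g
  ψ-injective = let (_ , _ , _ , _ , p , _) = facts in p
  ψ-onto : ∀ e → KE e → ∃ λ f → ψ f ≡ inj₁ e
  ψ-onto = let (_ , _ , _ , _ , _ , _ , p , _) = facts in p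
  spoke : Fin 3 → Edge H
  spoke i = let (_ , _ , _ , _ , _ , _ , _ , p , _) = facts in proj₁ (p i)
  ψ-spoke : ∀ i → ψ (spoke i) ≡ inj₂ i
  ψ-spoke i = let (_ , _ , _ , _ , _ , _ , _ , p , _) = facts in proj₂ (p i)
  old-ends : ∀ f e → ψ f ≡ inj₁ e → UEq (mapPair φ (ends H f)) (mapPair just (ends G e))
  old-ends = let (_ , _ , _ , _ , _ , _ , _ , _ , p , _) = facts in p
  new-ends : ∀ f i → ψ f ≡ inj₂ i → UEq (mapPair φ (ends H f)) (nothing , just (a i))
  new-ends = let (_ , _ , _ , _ , _ , _ , _ , _ , _ , p) = facts in p

  -- the contraction of the complement of K
  ι : Vtx G → Vtx H
  ι v with K? v
  ... | yes k = proj₁ (φ-onto v k)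
  ... | no  _ = ∞

  φ-ι : ∀ {v} → K v → φ (ι v) ≡ just v
  φ-ι {v} k with K? v
  ... | yes k′ = proj₂ (φ-onto v k′)
  ... | no ¬k  = contradiction k ¬k

  ι-out : ∀ {v} → ¬ K v → ι v ≡ ∞
  ι-out {v} ¬k with K? v
  ... | yes k = contradiction k ¬k
  ... | no _  = refl

  φ≡just⇒ι : ∀ {x v} → φ x ≡ just v → ι v ≡ x
  φ≡just⇒ι p = φ-injective _ _ (trans (φ-ι (φ-K _ _ p)) (sym p))

  φ≡nothing⇒∞ : ∀ {x} → φ x ≡ nothing → ∞ ≡ x
  φ≡nothing⇒∞ p = φ-injective _ _ (trans φ-∞ (sym p))

  ι≢∞ : ∀ {v} → K v → ι v ≢ ∞
  ι≢∞ k p with trans (sym (φ-ι k)) (trans (cong φ p) φ-∞)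
  ... | ()

  ι-≢ : ∀ {u v} → K u → u ≢ v → ι u ≢ ι v
  ι-≢ {u} {v} ku u≢v eq with K? v
  ... | yes kv = u≢v (just-injective (trans (sym (φ-ι ku)) (trans (cong φ eq) (proj₂ (φ-onto v kv)))))
  ... | no  _  = ι≢∞ ku eq

  vertex : ∀ x → (∞ ≡ x) ⊎ (∃ λ v → K v × φ x ≡ just v)
  vertex x with φ x in eq
  ... | nothing = inj₁ (φ≡nothing⇒∞ eq)
  ... | just v  = inj₂ (v , φ-K x v eq , refl)

  ι-onto : ∀ x → ∃ λ v → ι v ≡ x
  ι-onto x with vertex x
  ... | inj₁ p = out₁ , trans (ι-out out₁∉) p
  ... | inj₂ (v , _ , p) = v , φ≡just⇒ι p

  edge : ∀ {h x y} → Joins H h x y →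
    (∃ λ e → ∃ λ u → ∃ λ w → ψ h ≡ inj₁ e × Joins G e u w × φ x ≡ just u × φ y ≡ just w) ⊎
    (∃ λ i → ψ h ≡ inj₂ i × UEq (φ x , φ y) (nothing , just (a i)))
  edge {h} {x} {y} j with ψ h in eq
  ... | inj₂ i = inj₂ (i , refl , UEq-trans (UEq-map φ (UEq-sym j)) (new-ends h i eq))
  ... | inj₁ e with UEq-trans (UEq-map φ (UEq-sym j)) (old-ends h e eq)
  ... | inj₁ (p , q) = inj₁ (e , _ , _ , refl , inj₁ (refl , refl) , p , q)
  ... | inj₂ (p , q) = inj₁ (e , _ , _ , refl , inj₂ (refl , refl) , p , q)

  old-edge : ∀ {e u w} → Joins G e u w → K u → K w → ∃ λ h → ψ h ≡ inj₁ e × Joins H h (ι u) (ι w)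
  old-edge {e} {u} {w} j ku kw with ψ-onto e (KE-all j ku kw)
  ... | h , eq = h , eq , UEq-unmap φ-injective
    (subst (UEq (mapPair φ (ends H h))) (sym both) (UEq-trans (old-ends h e eq) (UEq-map just j)))
    where
    both : (φ (ι u) , φ (ι w)) ≡ (just u , just w)
    both rewrite φ-ι ku | φ-ι kw = refl

  new-edge : ∀ i → Joins H (spoke i) ∞ (ι (a i))
  new-edge i = UEq-unmap φ-injective
    (subst (UEq (mapPair φ (ends H (spoke i)))) (sym both) (new-ends _ i (ψ-spoke i)))
    where
    both : (φ ∞ , φ (ι (a i))) ≡ (nothing , just (a i))
    both rewrite φ-∞ | φ-ι (attached i) = refl

  -- An edge leaving `K` does so at some `a i`, by `boundary`, and can be traced by the spoke there.
  -- Edges outside `K` collapse.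
  contract-edge : ∀ {e u w} → Joins G e u w → ι u ≡ ι w ⊎ (∃ λ h → Joins H h (ι u) (ι w))
  contract-edge {e} {u} {w} j = cases (K? u) (K? w)
    where
    crossing : ∀ {e u w} → Joins G e u w → K u → ¬ K w → ∃ λ h → Joins H h (ι w) (ι u)
    crossing j ku ¬kw with boundary j ku ¬kw
    ... | i , refl = spoke i , subst (λ x → Joins H (spoke i) x (ι (a i))) (sym (ι-out ¬kw)) (new-edge i)
    cases : Dec (K u) → Dec (K w) → ι u ≡ ι w ⊎ (∃ λ h → Joins H h (ι u) (ι w))
    cases (yes ku) (yes kw) = inj₂ (let h , _ , jh = old-edge j ku kw in h , jh)
    cases (yes ku) (no ¬kw) = inj₂ (let h , jh = crossing j ku ¬kw in h , Joins-sym {H} jh)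
    cases (no ¬ku) (yes kw) = inj₂ (crossing (Joins-sym {G} j) kw ¬ku)
    cases (no ¬ku) (no ¬kw) = inj₁ (trans (ι-out ¬ku) (sym (ι-out ¬kw)))

  uncut-∞ : ∀ t → Uncut H (λ v → v ≢ ∞ × v ≢ t) (AllE H)
  uncut-∞ t T closed {x} {y} (x≢∞ , x≢t) (y≢∞ , y≢t) with ι-onto t | vertex x | vertex y
  ... | _ | inj₁ p | _ = contradiction (sym p) x≢∞
  ... | _ | _ | inj₁ p = contradiction (sym p) y≢∞
  ... | t′ , refl | inj₂ (u , ku , p) | inj₂ (v , kv , q) with φ≡just⇒ι p | φ≡just⇒ι q
  ... | refl | refl = uncut-minus t′ (T ∘ ι) closed′ (ku , λ { refl → x≢t refl }) (kv , λ { refl → y≢t refl })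
    where
    closed′ : Closed G (λ v → K v × v ≢ t′) (AllE G) (T ∘ ι)
    closed′ j _ (ku , u≢t) (kw , w≢t) =
      let h , _ , jh = old-edge j ku kw
      in closed {h} jh tt (ι≢∞ ku , ι-≢ ku u≢t) (ι≢∞ kw , ι-≢ kw w≢t)

  -- If neither removed vertex is new, a colouring of `H` pulls back along `ι`, since contraction
  -- sends an edge to an edge or to a single vertex. If the new vertex is removed, the rest is an
  -- induced subgraph of `G` and `uncut-∞` applies.
  H-uncut₂ : ∀ s t → Uncut H (λ v → v ≢ s × v ≢ t) (AllE H)
  H-uncut₂ s t T closed {x} {y} x∉ y∉ with vertex s | vertex t
  ... | inj₁ refl | _ = uncut-∞ t T closed x∉ y∉
  ... | inj₂ _ | inj₁ refl = uncut-∞ s T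
    (λ {h} j k (p , q) (p′ , q′) → closed {h} j k (q , p) (q′ , p′))
    (let p , q = x∉ in q , p) (let p , q = y∉ in q , p)
  ... | inj₂ (s′ , ks , p) | inj₂ (t′ , kt , q) with φ≡just⇒ι p | φ≡just⇒ι q | ι-onto x | ι-onto y
  ... | refl | refl | u , refl | v , refl = uncut₂ three s′ t′ (T ∘ ι) closed′ (back x∉) (back y∉)
    where
    back : ∀ {v} → ι v ≢ ι s′ × ι v ≢ ι t′ → v ≢ s′ × v ≢ t′
    back (p , q) = p ∘ cong ι , q ∘ cong ι
    forth : ∀ {v} → v ≢ s′ × v ≢ t′ → ι v ≢ ι s′ × ι v ≢ ι t′
    forth (p , q) = ≢-sym (ι-≢ ks (≢-sym p)) , ≢-sym (ι-≢ kt (≢-sym q))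
    closed′ : Closed G (λ v → v ≢ s′ × v ≢ t′) (AllE G) (T ∘ ι)
    closed′ j _ u∉ w∉ with contract-edge j
    ... | inj₁ eq = cong T eq
    ... | inj₂ (h , jh) = closed {h} jh tt (forth u∉) (forth w∉)

  4≤order : 4 ℕ.≤ n H
  4≤order = injective⇒≤ {f = f} inj
    where
    f : Fin 4 → Vtx H
    f zero = ∞
    f (suc i) = ι (a i)
    inj : ∀ {i j} → f i ≡ f j → i ≡ j
    inj {zero} {zero} _ = refl
    inj {zero} {suc j} p = contradiction (sym p) (ι≢∞ (attached j))
    inj {suc i} {zero} p = contradiction p (ι≢∞ (attached i))
    inj {suc i} {suc j} p = cong suc (distinct (decidable-stable (a i ≟ a j) λ q → ι-≢ (attached i) q p))

  -- The new vertex is placed on `out₁`, which leaves `out₂` free for one further element in an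
  -- injection into the vertices of `G`.
  order< : n H ℕ.< n G
  order< = injective⇒≤ {f = f} inj
    where
    σ : Vtx H → Vtx G
    σ x = maybe′ id out₁ (φ x)
    σ≢out₂ : ∀ x → out₂ ≢ σ x
    σ≢out₂ x p with φ x in eq
    ... | nothing = out-distinct (sym p)
    ... | just v = out₂∉ (subst K (sym p) (φ-K x v eq))
    σ-injective : ∀ {x y} → σ x ≡ σ y → x ≡ y
    σ-injective {x} {y} p with φ x in eq₁ | φ y in eq₂
    ... | nothing | nothing = φ-injective x y (trans eq₁ (sym eq₂))
    ... | nothing | just v  = contradiction (subst K (sym p) (φ-K y v eq₂)) out₁∉
    ... | just u  | nothing = contradiction (subst K p (φ-K x u eq₁)) out₁∉
    ... | just u  | just v  = φ-injective x y (trans eq₁ (trans (cong just p) (sym eq₂)))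
    f : Fin (suc (n H)) → Vtx G
    f zero = out₂
    f (suc x) = σ x
    inj : ∀ {i j} → f i ≡ f j → i ≡ j
    inj {zero} {zero} _ = refl
    inj {zero} {suc y} p = contradiction p (σ≢out₂ y)
    inj {suc x} {zero} p = contradiction (sym p) (σ≢out₂ x)
    inj {suc x} {suc y} p = cong suc (σ-injective p)

  H-three : ThreeConnected H
  H-three = 4≤order , λ s t →
    uncut⇒connected (λ v → ¬? (v ≟ s) ×-dec ¬? (v ≟ t)) (λ _ → yes tt) (H-uncut₂ s t)

  -- The new vertex has only three spokes. Removing the end `a j` of one and deleting the other two
  -- isolates it, so every spoke lies in a degenerate separator.
  spoke-critical : ∀ i → ¬ V2EUncut H (spoke i)
  spoke-critical i uncut with others i
  ... | j , k , j≢i , k≢i , j≢k , rest = contradiction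
    (trans (sym (dec-true (∞ ≟ ∞) refl)) (trans
      (uncut (ι (a j)) (spoke k) (λ p → k≢i (spoke-injective p)) T closed
        (≢-sym (ι≢∞ (attached j))) (ι-≢ (attached i) λ p → j≢i (sym (distinct p))))
      (dec-false (ι (a i) ≟ ∞) (ι≢∞ (attached i))))) λ ()
    where
    spoke-injective : ∀ {i j} → spoke i ≡ spoke j → i ≡ j
    spoke-injective {i} {j} p = inj₂-injective (trans (sym (ψ-spoke i)) (trans (cong ψ p) (ψ-spoke j)))
    spoke-unique : ∀ {h l} → ψ h ≡ inj₂ l → spoke l ≡ h
    spoke-unique p = ψ-injective _ _ (trans (ψ-spoke _) (sym p))
    T : Vtx H → Bool
    T x = does (x ≟ ∞)
    closed : Closed H (_≢ ι (a j)) (λ h → h ≢ spoke i × h ≢ spoke k) T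
    closed {h} {x} {y} jh (h≢i , h≢k) x≢ y≢ with edge {h} jh
    ... | inj₁ (_ , u , w , _ , _ , p , q) with φ≡just⇒ι p | φ≡just⇒ι q
    ... | refl | refl = trans (dec-false (ι u ≟ ∞) (ι≢∞ (φ-K _ _ p))) (sym (dec-false (ι w ≟ ∞) (ι≢∞ (φ-K _ _ q))))
    closed {h} {x} {y} jh (h≢i , h≢k) x≢ y≢ | inj₂ (l , eq , ue) = ⊥-elim (l≢j l≡j ue)
      where
      l≡j : l ≡ j
      l≡j = decidable-stable (l ≟ j) λ n → h≢k (trans (sym (spoke-unique eq)) (cong spoke
        (rest l (λ { refl → h≢i (sym (spoke-unique eq)) }) n)))
      l≢j : ∀ {l} → l ≡ j → UEq (φ x , φ y) (nothing , just (a l)) → ⊥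
      l≢j refl (inj₁ (_ , q)) = y≢ (sym (φ≡just⇒ι q))
      l≢j refl (inj₂ (p , _)) = x≢ (sym (φ≡just⇒ι p))

  extend : Bool → (Vtx G → Bool) → Vtx H → Bool
  extend β T x = maybe′ T β (φ x)

  extend-just : ∀ {β x v} T → φ x ≡ just v → extend β T x ≡ T v
  extend-just T p rewrite p = refl

  extend-nothing : ∀ {β x} T → φ x ≡ nothing → extend β T x ≡ β
  extend-nothing T p rewrite p = refl

  -- A cut (z , f , T) of G avoiding e gives a cut of H avoiding g, where x gets colour β
  -- and where z becomes the new vertex if it is outside K.
  transfer : ∀ {g e p q} → V2EUncut H g → ψ g ≡ inj₁ e → Joins G e p q → K p → K q →
    ∀ {z f T} → Closed G (_≢ z) (λ h → h ≢ e × h ≢ f) T → p ≢ z → q ≢ z →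
    ∀ β g′ → g′ ≢ g →
    (∀ {h e′} → ψ h ≡ inj₁ e′ → h ≢ g′ → e′ ≢ f) →
    (K z → ∀ {h i} → ψ h ≡ inj₂ i → h ≢ g′ → a i ≢ z → T (a i) ≡ β) →
    T p ≡ T q
  transfer {g} {e} {p} {q} uncut ψg j kp kq {z} {f} {T} closed p≢z q≢z β g′ g′≢g avoids-f spokes =
    trans (sym (extend-just T (φ-ι kp))) (trans
      (uncut (ι z) g′ g′≢g (extend β T) closed′ (ι-≢ kp p≢z) (ι-≢ kq q≢z))
      (extend-just T (φ-ι kq)))
    where
    avoids-z : ∀ {x v} → φ x ≡ just v → x ≢ ι z → v ≢ z
    avoids-z r x≢ refl = x≢ (sym (φ≡just⇒ι r))
    -- If `z` were outside `K`, then `ι z` would be the new vertex, and no spoke would survive its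
    -- removal.
    z∈K : ∀ {x} → φ x ≡ nothing → x ≢ ι z → K z
    z∈K r x≢ = decidable-stable (K? z) λ ¬kz → x≢ (trans (sym (φ≡nothing⇒∞ r)) (sym (ι-out ¬kz)))
    closed′ : Closed H (_≢ ι z) (λ h → h ≢ g × h ≢ g′) (extend β T)
    closed′ {h} jh (h≢g , h≢g′) x≢ y≢ with edge {h} jh
    ... | inj₁ (e′ , u , w , eq , j′ , r , s) =
      trans (extend-just T r) (trans
        (closed {e′} j′ ((λ { refl → h≢g (ψ-injective _ _ (trans eq (sym ψg))) }) , avoids-f eq h≢g′)
          (avoids-z r x≢) (avoids-z s y≢))
        (sym (extend-just T s)))
    ... | inj₂ (i , eq , inj₁ (r , s)) =
      trans (extend-nothing T r) (trans (sym (spokes (z∈K r x≢) eq h≢g′ (avoids-z s y≢))) (sym (extend-just T s)))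
    ... | inj₂ (i , eq , inj₂ (r , s)) =
      trans (extend-just T r) (trans (spokes (z∈K s y≢) eq h≢g′ (avoids-z r x≢)) (sym (extend-nothing T s)))

  -- If no separator of `H` contained `g`, then by `transfer` every colouring closed away from `z`,
  -- `e` and `f` would agree at the ends of `e`, so `e` would lie in no separator of `G`.
  old-critical : ∀ {g e} → ψ g ≡ inj₁ e → ¬ V2EUncut H g
  old-critical {g} {e} ψg uncut = crit e G-uncut
    where
    p q : Vtx G
    p = proj₁ (ends G e)
    q = proj₂ (ends G e)
    ends-K : ∀ {h e} → ψ h ≡ inj₁ e → K (proj₁ (ends G e)) × K (proj₂ (ends G e))
    ends-K {h} {e} eq with old-ends h e eq
    ... | inj₁ (r , s) = φ-K _ _ r , φ-K _ _ s
    ... | inj₂ (r , s) = φ-K _ _ s , φ-K _ _ r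
    spoke≢g : ∀ i → spoke i ≢ g
    spoke≢g i refl with trans (sym (ψ-spoke i)) ψg
    ... | ()
    module _ {z : Vtx G} {f : Edge G} {T : Vtx G → Bool} (f≢e : f ≢ e) (closed : Closed G (_≢ z) (λ h → h ≢ e × h ≢ f) T)
             (p≢z : p ≢ z) (q≢z : q ≢ z) where
      go : ∀ β g′ → g′ ≢ g → (∀ {h e′} → ψ h ≡ inj₁ e′ → h ≢ g′ → e′ ≢ f) →
        (K z → ∀ {h i} → ψ h ≡ inj₂ i → h ≢ g′ → a i ≢ z → T (a i) ≡ β) → T p ≡ T q
      go = transfer uncut ψg (Joins-ends G e) (proj₁ (ends-K ψg)) (proj₂ (ends-K ψg))
             {f = f} (λ {h} → closed {h}) p≢z q≢z
      keep-colour : T p ≡ T q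
      keep-colour with K? (proj₁ (ends G f)) ×-dec K? (proj₂ (ends G f))
      -- Since `f` has no copy in `H`, the second deleted edge may be the one spoke whose end can
      -- miss the majority colour.
      ... | no f∉K with majority (T ∘ a)
      ...   | β , k , maj = go β (spoke k) (spoke≢g k)
              (λ { eq _ refl → f∉K (ends-K eq) })
              (λ _ {h} {i} eq h≢ _ → maj i λ { refl → h≢ (ψ-injective _ _ (trans eq (sym (ψ-spoke i)))) })
      -- Here `f` has a copy `g′`. The new vertex takes the colour of some `a i` other than `z`, and
      -- `linked` makes the other surviving attachment vertices agree with it.
      keep-colour | yes (k₁ , k₂) with old-edge (Joins-ends G f) k₁ k₂ | avoiding {k = 1} (s≤s (s≤s z≤n)) a distinct (λ _ → z)
      ...   | g′ , ψg′ , _ | i , avoid = go (T (a i)) g′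
              (λ { refl → f≢e (inj₁-injective (trans (sym ψg′) ψg)) })
              (λ { eq h≢ refl → h≢ (ψ-injective _ _ (trans eq (sym ψg′))) })
              (λ kz {h} {i′} _ _ a≢z → linked kz T outside i′ i a≢z (avoid zero))
        where
        outside : ∀ {h u w} → Joins G h u w → ¬ (K u × K w) → u ≢ z → w ≢ z → T u ≡ T w
        outside {h} j ¬K = closed {h} j
          ( (λ { refl → ¬K (both (Joins-unique {G} (Joins-ends G e) j) (ends-K ψg)) })
          , (λ { refl → ¬K (both (Joins-unique {G} (Joins-ends G f) j) (k₁ , k₂)) }) )
          where
          both : ∀ {x y u w} → UEq (x , y) (u , w) → K x × K y → K u × K w
          both (inj₁ (refl , refl)) kk = kk
          both (inj₂ (refl , refl)) (k , k′) = k′ , k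
    G-uncut : V2EUncut G e
    -- Once its ends agree, `e` can be put back, and only `z` and `f` stay removed.
    G-uncut z f f≢e T closed = uncut₁₁ three z f T closed′
      where
      same : p ≢ z → q ≢ z → T p ≡ T q
      same = keep-colour {z} {f} {T} f≢e (λ {h} → closed {h})
      closed′ : Closed G (_≢ z) (_≢ f) T
      closed′ {h} j h≢f u≢z w≢z with h ≟ e
      ... | no h≢e = closed {h} j (h≢e , h≢f) u≢z w≢z
      ... | yes refl with j
      ... | inj₁ (refl , refl) = same u≢z w≢z
      ... | inj₂ (refl , refl) = sym (same w≢z u≢z)

  H-critical : ∀ g → ¬ TwoHalfConnected (deleteEdge H g)
  H-critical g twoHalf with ψ g in eq | twoHalf⇒V2EUncut H 4≤order g twoHalf
  ... | inj₁ e | uncut = old-critical eq uncut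
  ... | inj₂ i | uncut = spoke-critical i
    (subst (V2EUncut H) (ψ-injective _ _ (trans eq (sym (ψ-spoke i)))) uncut)

  goodPart : GoodPart G H
  goodPart = (three⇒twoHalf H-three , H-critical) , H-three , order<

-- Components and recolouring

-- An edge whose ends differ in colour has exactly one end coloured `b` and can be read from that
-- end.
closed-if : ∀ {G KV KE} T b →
  (∀ {e u w} → Joins G e u w → KE e → KV u → KV w → T u ≡ b → T w ≢ b → ⊥) → Closed G KV KE T
closed-if {G} T b ¬cross {e} {u} {w} j ke ku kw with T u Bool.≟ b | T w Bool.≟ b
... | yes p | yes q = trans p (sym q)
... | yes p | no ¬q = ⊥-elim (¬cross {e} j ke ku kw p ¬q)
... | no ¬p | yes q = ⊥-elim (¬cross {e} (Joins-sym {G} j) ke kw ku q ¬p)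
... | no ¬p | no ¬q = two-valued ¬p ¬q

third : ∀ {i j : Fin 3} → i ≢ j → ∃ λ k → ∀ l → l ≢ i → l ≢ j → l ≡ k
third {i} {j} i≢j with others i
... | j′ , k′ , _ , _ , _ , rest with j ≟ j′
... | yes refl = k′ , rest
... | no j≢j′ with rest j (≢-sym i≢j) j≢j′
... | refl = j′ , λ l l≢i l≢j → decidable-stable (l ≟ j′) λ l≢j′ → l≢j (rest l l≢i l≢j′)

one-differs : ∀ {n} {x y : Fin n} → x ≢ y → ∀ z → x ≢ z ⊎ y ≢ z
one-differs {x = x} x≢y z with x ≟ z
... | yes refl = inj₂ (≢-sym x≢y)
... | no x≢z = inj₁ x≢z

-- Walks that start in a component never leave it, so they only use edges between vertices of `C`.
component-uncut : ∀ {G KV KE C} → IsComponent G KV KE C → Uncut G C (AllE G)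
component-uncut {G} {KV} {KE} {C} (_ , _ , conn , closure) T closed cu cv = go cu (conn _ _ cu cv)
  where
  go : ∀ {u v} → C u → Walk G KV KE u v → T u ≡ T v
  go cu (nil _) = refl
  go cu (cons e ke ku j p) =
    let cw = closure _ _ cu (edge-walk ke ku (start p) j)
    in trans (closed {e} j tt cu cw) (go cw p)

component-step : ∀ {G KV KE C} → IsComponent G KV KE C →
  ∀ {e u w} → Joins G e u w → KE e → C u → KV w → C w
component-step (_ , sub , _ , closure) j ke cu kw = closure _ _ cu (edge-walk ke (sub _ cu) kw j)

-- Giving everything outside `K` one colour turns a colouring of `K` into one of `G`, to which
-- 3-connectivity applies. Only edges leaving `K` then need attention.
module Patch {G : Graph} {K : Vtx G → Set} (K? : Decidable K) (T : Vtx G → Bool) (β : Bool) where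

  patch : Vtx G → Bool
  patch w = if does (K? w) then T w else β

  patch-in : ∀ {w} → K w → patch w ≡ T w
  patch-in {w} k with K? w
  ... | yes _ = refl
  ... | no ¬k = contradiction k ¬k

  patch-out : ∀ {w} → ¬ K w → patch w ≡ β
  patch-out {w} ¬k with K? w
  ... | yes k = contradiction k ¬k
  ... | no _  = refl

  patch-closed : ∀ {KV KE} →
    (∀ {e u w} → Joins G e u w → KE e → KV u → KV w → K u → K w → T u ≡ T w) →
    (∀ {e u w} → Joins G e u w → KE e → KV u → KV w → K u → ¬ K w → T u ≡ β) →
    Closed G KV KE patch
  patch-closed inside across {e} {u} {w} j ke ku kw with K? u | K? w
  ... | yes p | yes q = inside {e} j ke ku kw p q
  ... | yes p | no ¬q = across {e} j ke ku kw p ¬q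
  ... | no ¬p | yes q = sym (across {e} (Joins-sym {G} j) ke kw ku q ¬p)
  ... | no _  | no _  = refl

-- Vertex-2-edge-separators and their ends

Separates : (G : Graph) → Vtx G → Edge G → Edge G → Set
Separates G c e₁ e₂ = ¬ Uncut G (_≢ c) (λ f → f ≢ e₁ × f ≢ e₂)

separates : ∀ {G c e₁ e₂} → ¬ Connected G (_≢ c) (λ f → f ≢ e₁ × f ≢ e₂) → Separates G c e₁ e₂
separates {c = c} {e₁} {e₂} ¬conn uncut =
  ¬conn (uncut⇒connected (λ v → ¬? (v ≟ c)) (λ f → ¬? (f ≟ e₁) ×-dec ¬? (f ≟ e₂)) uncut)

module _ {G : Graph} (three : ThreeConnected G) where

  separates-swap : ∀ {c e₁ e₂} → Separates G c e₁ e₂ → Separates G c e₂ e₁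
  separates-swap sep uncut = sep λ T closed → uncut T λ {h} j (p , q) → closed {h} j (q , p)

  -- Removing `c` would already remove an incident `e₁`, and one further edge cannot disconnect `G`
  -- minus `c`.
  separator-edge∌ : ∀ {c e₁ e₂} → Separates G c e₁ e₂ → ¬ IsEnd G e₁ c
  separator-edge∌ {c} {e₁} {e₂} sep end = sep λ T closed → uncut₁₁ three c e₂ T λ {h} j h≢e₂ u≢c w≢c →
    closed {h} j ((λ { refl → [ u≢c , w≢c ] (IsEnd-Joins {G} {e₁} end j) }) , h≢e₂) u≢c w≢c

  separator-edges-distinct : ∀ {c e₁ e₂} → Separates G c e₁ e₂ → e₁ ≢ e₂
  separator-edges-distinct {c} {e₁} sep refl = sep λ T closed →
    uncut₁₁ three c e₁ T λ {h} j h≢ → closed {h} j (h≢ , h≢)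

-- The colour of c under S is arbitrary, so that this covers 3-edge-cuts as well.
module CutVertex {G : Graph} (three : ThreeConnected G) (crit : Critical G)
  {c : Vtx G} {e₁ e₂ : Edge G} (sep : Separates G c e₁ e₂)
  (S : Vtx G → Bool) (b : Bool)
  (crossing : ∀ {f x y} → Joins G f x y → x ≢ c → y ≢ c → S x ≡ b → S y ≢ b → f ≡ e₁ ⊎ f ≡ e₂)
  {u₁ u₂ v₁ v₂ : Vtx G} (j₁ : Joins G e₁ u₁ v₁) (j₂ : Joins G e₂ u₂ v₂)
  (u₁∈ : S u₁ ≡ b) (u₂∈ : S u₂ ≡ b) (v₁∉ : S v₁ ≢ b) (v₂∉ : S v₂ ≢ b)
  where

  avoids-c : ∀ {e f u w} → Separates G c e f → Joins G e u w → u ≢ c × w ≢ c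
  avoids-c s j = (λ { refl → separator-edge∌ three s (Joins⇒IsEnd {G} j) })
               , (λ { refl → separator-edge∌ three s (Joins⇒IsEnd {G} (Joins-sym {G} j)) })
  sep′ : Separates G c e₂ e₁
  sep′ = separates-swap three sep
  u₁≢c : u₁ ≢ c
  u₁≢c = proj₁ (avoids-c sep j₁)
  v₁≢c : v₁ ≢ c
  v₁≢c = proj₂ (avoids-c sep j₁)
  u₂≢c : u₂ ≢ c
  u₂≢c = proj₁ (avoids-c sep′ j₂)
  v₂≢c : v₂ ≢ c
  v₂≢c = proj₂ (avoids-c sep′ j₂)

  crossing-end : ∀ {f x y} → Joins G f x y → x ≢ c → y ≢ c → S x ≡ b → S y ≢ b →
    (f ≡ e₁ × x ≡ u₁ × y ≡ v₁) ⊎ (f ≡ e₂ × x ≡ u₂ × y ≡ v₂)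
  crossing-end {f} j x≢c y≢c x∈ y∉ with crossing {f} j x≢c y≢c x∈ y∉
  ... | inj₁ refl with Joins-unique {G} j j₁
  ...   | inj₁ (p , q) = inj₁ (refl , p , q)
  ...   | inj₂ (refl , refl) = contradiction u₁∈ y∉
  crossing-end {f} j x≢c y≢c x∈ y∉ | inj₂ refl with Joins-unique {G} j j₂
  ...   | inj₁ (p , q) = inj₂ (refl , p , q)
  ...   | inj₂ (refl , refl) = contradiction u₂∈ y∉

  -- Suppose both edges leave the side at `u₁`. Another vertex on this side is separated from `v₁`
  -- by `c` and `u₁`. Otherwise the side is `u₁` alone: with an edge to `c`, unique by
  -- `no-parallel`, it has degree three and the separator is degenerate; without one, `v₁` and `v₂`
  -- isolate it from `c`.
  ends-distinct : ¬ Degenerate G c e₁ e₂ → u₁ ≢ u₂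
  ends-distinct ¬deg refl with any? (λ a → ¬? (a ≟ c) ×-dec ((S a Bool.≟ b) ×-dec ¬? (a ≟ u₁)))
  ... | yes (a , a≢c , a∈ , a≢u) = v₁∉ (trans (sym (uncut₂ three c u₁ S closed (a≢c , a≢u) (v₁≢c , v₁≢u))) a∈)
    where
    v₁≢u : v₁ ≢ u₁
    v₁≢u refl = v₁∉ u₁∈
    closed : Closed G (λ v → v ≢ c × v ≢ u₁) (AllE G) S
    closed = closed-if {G} {λ v → v ≢ c × v ≢ u₁} {AllE G} S b cross
      where
      cross : ∀ {e u w} → Joins G e u w → AllE G e → u ≢ c × u ≢ u₁ → w ≢ c × w ≢ u₁ → S u ≡ b → S w ≢ b → ⊥
      cross j _ (x≢c , x≢u) (y≢c , _) p q with crossing-end j x≢c y≢c p q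
      ... | inj₁ (_ , r , _) = x≢u r
      ... | inj₂ (_ , r , _) = x≢u r
  ... | no ¬a with any? (λ e → UEq? (ends G e) (u₁ , c))
  ... | yes (e₀ , j₀) = ¬deg
    ( u₁ , e₀ , deg≡3 G e₀≢e₁ e₀≢e₂ (separator-edges-distinct three sep) end₀ end₁ end₂ only
    , e₀≢e₁ , e₀≢e₂ , separator-edges-distinct three sep , end₀ , end₁ , end₂ , j₀ )
    where
    end₀ : IsEnd G e₀ u₁
    end₀ = Joins⇒IsEnd {G} j₀
    end₁ : IsEnd G e₁ u₁
    end₁ = Joins⇒IsEnd {G} j₁
    end₂ : IsEnd G e₂ u₁
    end₂ = Joins⇒IsEnd {G} j₂
    e₀∋c : IsEnd G e₀ c
    e₀∋c = Joins⇒IsEnd {G} (Joins-sym {G} j₀)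
    e₀≢e₁ : e₀ ≢ e₁
    e₀≢e₁ refl = separator-edge∌ three sep e₀∋c
    e₀≢e₂ : e₀ ≢ e₂
    e₀≢e₂ refl = separator-edge∌ three sep′ e₀∋c
    only : ∀ f → IsEnd G f u₁ → f ∈ e₀ ∷ e₁ ∷ e₂ ∷ []
    only f end with other-end G {f} end
    ... | y , j with y ≟ c
    ... | yes refl = here (no-parallel three crit j j₀)
    ... | no y≢c with S y Bool.≟ b
    ... | yes y∈ = ⊥-elim (¬a (y , y≢c , y∈ , ≢-sym (Joins⇒≢ {G} {f} j)))
    ... | no y∉ with crossing {f} j u₁≢c y≢c u₁∈ y∉
    ... | inj₁ p = there (here p)
    ... | inj₂ p = there (there (here p))
  ... | no ¬e₀ = contradiction
    (trans (sym (dec-true (u₁ ≟ u₁) refl)) (trans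
      (uncut₂ three v₁ v₂ T closed (u≢v₁ , u≢v₂) (≢-sym v₁≢c , ≢-sym v₂≢c))
      (dec-false (c ≟ u₁) (≢-sym u₁≢c)))) λ ()
    where
    u≢v₁ : u₁ ≢ v₁
    u≢v₁ refl = v₁∉ u₁∈
    u≢v₂ : u₁ ≢ v₂
    u≢v₂ refl = v₂∉ u₁∈
    T : Vtx G → Bool
    T w = does (w ≟ u₁)
    no-edge : ∀ {e w} → Joins G e u₁ w → w ≢ v₁ → w ≢ v₂ → ⊥
    no-edge {e} {w} j w≢v₁ w≢v₂ with w ≟ c
    ... | yes refl = ¬e₀ (e , j)
    ... | no w≢c with S w Bool.≟ b
    ... | yes w∈ = ¬a (w , w≢c , w∈ , ≢-sym (Joins⇒≢ {G} {e} j))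
    ... | no w∉ with crossing-end {e} j u₁≢c w≢c u₁∈ w∉
    ... | inj₁ (_ , _ , p) = w≢v₁ p
    ... | inj₂ (_ , _ , p) = w≢v₂ p
    closed : Closed G (λ v → v ≢ v₁ × v ≢ v₂) (AllE G) T
    closed {e} {x} {y} j _ (x≢₁ , x≢₂) (y≢₁ , y≢₂) with x ≟ u₁ | y ≟ u₁
    ... | yes _ | yes _ = refl
    ... | yes refl | no _ = ⊥-elim (no-edge {e} j y≢₁ y≢₂)
    ... | no _ | yes refl = ⊥-elim (no-edge {e} (Joins-sym {G} j) x≢₁ x≢₂)
    ... | no _ | no _ = refl

-- Sides of a 3-edge-cut

module ThreeEdgeCut {G : Graph} (three : ThreeConnected G) (S : Vtx G → Bool) (b : Bool)
  (e : Fin 3 → Edge G) (u v : Fin 3 → Vtx G)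
  (joins : ∀ i → Joins G (e i) (u i) (v i)) (u∈ : ∀ i → S (u i) ≡ b) (v∉ : ∀ i → S (v i) ≢ b)
  (crossing : ∀ {f x y} → Joins G f x y → S x ≡ b → S y ≢ b → ∃ λ i → f ≡ e i)
  where

  crossing-end : ∀ {f x y} → Joins G f x y → S x ≡ b → S y ≢ b → ∃ λ i → x ≡ u i × y ≡ v i
  crossing-end {f} j x∈ y∉ with crossing {f} j x∈ y∉
  ... | i , refl with Joins-unique {G} j (joins i)
  ... | inj₁ (p , q) = i , p , q
  ... | inj₂ (refl , q) = contradiction x∈ (v∉ i)

  -- If two cut edges shared the end `u i`, removing it and the far end `v k` of the third would
  -- destroy the whole cut. With two vertices on either side, one survives on each, against
  -- 3-connectivity.
  ends-distinct : ∀ {a a′ d d′} → S a ≡ b → S a′ ≡ b → a ≢ a′ → S d ≢ b → S d′ ≢ b → d ≢ d′ →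
    ∀ {i j} → u i ≡ u j → i ≡ j
  ends-distinct {a} {a′} {d} {d′} a∈ a′∈ a≢a′ d∉ d′∉ d≢d′ {i} {j} ui≡uj =
    decidable-stable (i ≟ j) λ i≢j → two-left (third i≢j)
    where
    two-left : (∃ λ k → ∀ l → l ≢ i → l ≢ j → l ≡ k) → ⊥
    two-left (k , rest) with one-differs a≢a′ (u i) | one-differs d≢d′ (v k)
    ... | p | q = choose p q
      where
      cross : ∀ {f x y} → Joins G f x y → AllE G f → x ≢ u i × x ≢ v k → y ≢ u i × y ≢ v k → S x ≡ b → S y ≢ b → ⊥
      cross {f} jn _ (x≢ , _) (_ , y≢) x∈ y∉ with crossing-end {f} jn x∈ y∉
      ... | l , refl , refl = y≢ (cong v (rest l (λ { refl → x≢ refl }) (λ { refl → x≢ (sym ui≡uj) })))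
      separated : ∀ {x y} → S x ≡ b → S y ≢ b → x ≢ u i → y ≢ v k → ⊥
      separated x∈ y∉ x≢ y≢ = y∉ (trans (sym (uncut₂ three (u i) (v k) S
        (closed-if {G} {λ x → x ≢ u i × x ≢ v k} {AllE G} S b cross)
        (x≢ , λ { refl → v∉ k x∈ }) ((λ { refl → y∉ (u∈ i) }) , y≢))) x∈)
      choose : a ≢ u i ⊎ a′ ≢ u i → d ≢ v k ⊎ d′ ≢ v k → ⊥
      choose (inj₁ p) (inj₁ q) = separated a∈ d∉ p q
      choose (inj₁ p) (inj₂ q) = separated a∈ d′∉ p q
      choose (inj₂ p) (inj₁ q) = separated a′∈ d∉ p q
      choose (inj₂ p) (inj₂ q) = separated a′∈ d′∉ p q

  module _ (u-injective : ∀ {i j} → u i ≡ u j → i ≡ j) (v-injective : ∀ {i j} → v i ≡ v j → i ≡ j)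
           (uncut-outside : Uncut G (λ w → S w ≢ b) (AllE G)) where

    K : Vtx G → Set
    K w = S w ≡ b

    -- The minority colour among the u i occurs at most at one u k, so {t , v k} would
    -- separate the minority side from the rest.
    uncut-minus : ∀ t → Uncut G (λ w → K w × w ≢ t) (AllE G)
    uncut-minus t T closed {x} {y} (x∈ , x≢t) (y∈ , y≢t) = decidable-stable (T x Bool.≟ T y) split
      where
      β : Bool
      β = proj₁ (majority (T ∘ u))
      k : Fin 3
      k = proj₁ (proj₂ (majority (T ∘ u)))
      maj : ∀ i → i ≢ k → T (u i) ≡ β
      maj = proj₂ (proj₂ (majority (T ∘ u)))
      open Patch {G} (λ w → S w Bool.≟ b) T β
      across : ∀ {f x y} → Joins G f x y → AllE G f → x ≢ t × x ≢ v k → y ≢ t × y ≢ v k → K x → ¬ K y → T x ≡ β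
      across {f} j _ _ (_ , y≢) x∈ y∉ with crossing-end {f} j x∈ y∉
      ... | i , refl , refl = maj i λ { refl → y≢ refl }
      majority-only : ∀ {p} → K p → p ≢ t → T p ≡ β
      majority-only p∈ p≢t with avoiding {k = 2} ℕ.≤-refl v v-injective (λ { zero → t ; (suc _) → v k })
      ... | i , avoid = trans (sym (patch-in p∈)) (trans
        (uncut₂ three t (v k) patch
          (patch-closed (λ {f} j _ (x≢ , _) (y≢ , _) x∈ y∈ → closed {f} j tt (x∈ , x≢) (y∈ , y≢)) across)
          (p≢t , λ { refl → v∉ k p∈ }) (avoid zero , avoid (suc zero)))
        (patch-out (v∉ i)))
      split : T x ≢ T y → ⊥
      split x≢y = x≢y (trans (majority-only x∈ x≢t) (sym (majority-only y∈ y≢t)))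

    side : Side G K u
    side = record
      { K? = λ w → S w Bool.≟ b
      ; attached = u∈
      ; distinct = u-injective
      ; boundary = λ {f} j x∈ y∉ → let i , p , _ = crossing-end {f} j x∈ y∉ in i , sym p
      ; uncut-minus = uncut-minus
      ; linked = linked
      ; out₁ = v zero
      ; out₂ = v (suc zero)
      ; out₁∉ = v∉ zero
      ; out₂∉ = v∉ (suc zero)
      ; out-distinct = λ p → contradiction (v-injective p) λ ()
      }
      where
      -- As `z` lies in `K`, the other side is intact and connected, and each surviving `u i` is
      -- tied to it by its own cut edge.
      linked : ∀ {z} → K z → ∀ (T : Vtx G → Bool) →
        (∀ {e u w} → Joins G e u w → ¬ (K u × K w) → u ≢ z → w ≢ z → T u ≡ T w) →
        ∀ i j → u i ≢ z → u j ≢ z → T (u i) ≡ T (u j)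
      linked {z} z∈ T closed i j ui≢z uj≢z = trans (across i ui≢z) (trans
        (uncut-outside T (λ {f} jn _ x∉ y∉ → closed {f} jn (x∉ ∘ proj₁) (∉⇒≢z x∉) (∉⇒≢z y∉)) (v∉ i) (v∉ j))
        (sym (across j uj≢z)))
        where
        ∉⇒≢z : ∀ {x} → ¬ K x → x ≢ z
        ∉⇒≢z x∉ refl = x∉ z∈
        across : ∀ i → u i ≢ z → T (u i) ≡ T (v i)
        across i ui≢z = closed (joins i) (v∉ i ∘ proj₂) ui≢z (∉⇒≢z (v∉ i))

-- Sides of a separator that does not extend to a 3-edge-cut at its vertex

module CutVertexSide {G : Graph} (three : ThreeConnected G) (crit : Critical G)
  {c : Vtx G} {e₁ e₂ : Edge G} (sep : Separates G c e₁ e₂)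
  (not-cut : ∀ e₀ → IsEnd G e₀ c → ¬ ¬ Connected G (AllV G) (λ f → f ≢ e₀ × f ≢ e₁ × f ≢ e₂))
  (S : Vtx G → Bool) (b : Bool)
  (crossing : ∀ {f x y} → Joins G f x y → x ≢ c → y ≢ c → S x ≡ b → S y ≢ b → f ≡ e₁ ⊎ f ≡ e₂)
  {u₁ u₂ v₁ v₂ : Vtx G} (j₁ : Joins G e₁ u₁ v₁) (j₂ : Joins G e₂ u₂ v₂)
  (u₁∈ : S u₁ ≡ b) (u₂∈ : S u₂ ≡ b) (v₁∉ : S v₁ ≢ b) (v₂∉ : S v₂ ≢ b)
  (u₁≢u₂ : u₁ ≢ u₂)
  where

  open CutVertex three crit sep S b (λ {f} → crossing {f}) j₁ j₂ u₁∈ u₂∈ v₁∉ v₂∉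
    using (crossing-end; u₁≢c; u₂≢c; v₁≢c; v₂≢c)

  C : Vtx G → Set
  C w = w ≢ c × S w ≡ b

  C? : Decidable C
  C? w = ¬? (w ≟ c) ×-dec (S w Bool.≟ b)

  private
    module Indicator = Patch {G} C? (λ _ → true) false
  open Indicator using () renaming (patch to inside)

  inside-closed : ∀ {KV KE} → (∀ {f x y} → Joins G f x y → KE f → KV x → KV y → C x → ¬ C y → ⊥) →
    Closed G KV KE inside
  inside-closed ¬cross = Indicator.patch-closed (λ _ _ _ _ _ _ → refl)
    λ {f} j kf kx ky x∈ y∉ → ⊥-elim (¬cross {f} j kf kx ky x∈ y∉)

  inside-true≢ : ∀ {x y} → C x → ¬ C y → inside x ≢ inside y
  inside-true≢ x∈ y∉ eq with trans (sym (Indicator.patch-in x∈)) (trans eq (Indicator.patch-out y∉))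
  ... | ()

  c∉C : ¬ C c
  c∉C (c≢c , _) = c≢c refl

  ¬C⇒∉ : ∀ {y} → ¬ C y → y ≢ c → S y ≢ b
  ¬C⇒∉ ¬cy y≢c y∈ = ¬cy (y≢c , y∈)

  -- Removing `u₁` and `v₂` destroys both `e₁` and `e₂`, so without an edge from `c` into the side,
  -- `u₂` would be separated from `c`.
  neighbour : ∃ λ f → ∃ λ a → Joins G f c a × S a ≡ b
  neighbour with any? (λ f → any? λ a → UEq? (ends G f) (c , a) ×-dec (S a Bool.≟ b))
  ... | yes found = found
  ... | no none = contradiction
    (uncut₂ three u₁ v₂ inside (inside-closed cross)
      (≢-sym u₁≢u₂ , λ { refl → v₂∉ u₂∈ }) (≢-sym u₁≢c , ≢-sym v₂≢c))
    (inside-true≢ (u₂≢c , u₂∈) c∉C)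
    where
    cross : ∀ {f x y} → Joins G f x y → AllE G f → x ≢ u₁ × x ≢ v₂ → y ≢ u₁ × y ≢ v₂ → C x → ¬ C y → ⊥
    cross {f} {x} {y} j _ (x≢ , _) (_ , y≢) (x≢c , x∈) ¬cy with y ≟ c
    ... | yes refl = none (f , x , Joins-sym {G} j , x∈)
    ... | no y≢c with crossing-end {f} j x≢c y≢c x∈ (¬C⇒∉ ¬cy y≢c)
    ... | inj₁ (_ , p , _) = x≢ p
    ... | inj₂ (_ , _ , p) = y≢ p

  -- Otherwise the unique edge from c to C would form a 3-edge-cut with e₁ and e₂.
  neighbour-avoiding : ∀ t → ∃ λ f → ∃ λ a → Joins G f c a × S a ≡ b × a ≢ t
  neighbour-avoiding t
    with any? (λ f → any? λ a → UEq? (ends G f) (c , a) ×-dec ((S a Bool.≟ b) ×-dec ¬? (a ≟ t))) | neighbour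
  ... | yes found | _ = found
  ... | no none | e₀ , a₀ , j₀ , a₀∈ = ⊥-elim (not-cut e₀ (Joins⇒IsEnd {G} j₀) λ conn →
    inside-true≢ (u₁≢c , u₁∈) c∉C (connected⇒uncut conn inside (inside-closed cross) tt tt))
    where
    only-t : ∀ {f a} → Joins G f c a → S a ≡ b → a ≡ t
    only-t {f} {a} j a∈ = decidable-stable (a ≟ t) λ a≢t → none (f , a , j , a∈ , a≢t)
    cross : ∀ {f x y} → Joins G f x y → f ≢ e₀ × f ≢ e₁ × f ≢ e₂ → AllV G x → AllV G y → C x → ¬ C y → ⊥
    cross {f} {x} {y} j (f≢e₀ , f≢e₁ , f≢e₂) _ _ (x≢c , x∈) ¬cy with y ≟ c
    ... | yes refl = f≢e₀ (no-parallel three crit (Joins-sym {G} j)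
      (subst (Joins G e₀ c) (trans (only-t {e₀} j₀ a₀∈) (sym (only-t {f} (Joins-sym {G} j) x∈))) j₀))
    ... | no y≢c with crossing {f} j x≢c y≢c x∈ (¬C⇒∉ ¬cy y≢c)
    ... | inj₁ p = f≢e₁ p
    ... | inj₂ p = f≢e₂ p

  K : Vtx G → Set
  K w = w ≡ c ⊎ C w

  K? : Decidable K
  K? w = (w ≟ c) ⊎-dec C? w

  out-∉ : ∀ {w} → w ≢ c → S w ≢ b → ¬ K w
  out-∉ w≢c _ (inj₁ p) = w≢c p
  out-∉ _ w∉ (inj₂ (_ , p)) = w∉ p

  ∉⇒out : ∀ {w} → ¬ K w → w ≢ c × S w ≢ b
  ∉⇒out ¬k = (¬k ∘ inj₁) , λ w∈ → ¬k (inj₂ ((¬k ∘ inj₁) , w∈))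

  v₁∉K : ¬ K v₁
  v₁∉K = out-∉ v₁≢c v₁∉
  v₂∉K : ¬ K v₂
  v₂∉K = out-∉ v₂≢c v₂∉

  boundary-end : ∀ {f x y} → Joins G f x y → K x → ¬ K y →
    x ≡ c ⊎ (x ≡ u₁ × y ≡ v₁) ⊎ (x ≡ u₂ × y ≡ v₂)
  boundary-end j (inj₁ p) _ = inj₁ p
  boundary-end {f} j (inj₂ (x≢c , x∈)) ¬ky with crossing-end {f} j x≢c (proj₁ (∉⇒out ¬ky)) x∈ (proj₂ (∉⇒out ¬ky))
  ... | inj₁ (_ , p) = inj₂ (inj₁ p)
  ... | inj₂ (_ , p) = inj₂ (inj₂ p)

  module _ (v₁≢v₂ : v₁ ≢ v₂) (uncut-C : Uncut G C (AllE G))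
    (uncut-outside : Uncut G (λ w → w ≢ c × S w ≢ b) (AllE G))
    (outer-neighbour : ∃ λ f → ∃ λ d → Joins G f c d × S d ≢ b) where

    -- If `t` is `c`, the component `C` is connected. Otherwise all vertices are compared with `c`,
    -- according to whether `u₁` or `u₂` has its colour.
    uncut-minus : ∀ t → Uncut G (λ w → K w × w ≢ t) (AllE G)
    uncut-minus t T closed {x} {y} (x∈ , x≢t) (y∈ , y≢t) = cases (c ≟ t) x∈ x≢t y∈ y≢t
      where
      -- Everything outside `K` takes the colour of `c`. Only one of `e₁` and `e₂` can violate this,
      -- and the removal of its outer end `v` destroys it.
      removing : c ≢ t → ∀ {v} → ¬ K v →
        (∀ {x y} → (x ≡ u₁ × y ≡ v₁) ⊎ (x ≡ u₂ × y ≡ v₂) → y ≢ v → T x ≡ T c) →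
        ∀ {p} → C p → p ≢ t → T p ≡ T c
      removing c≢t {v} ¬kv ends p∈ p≢t = trans (sym (patch-in (inj₂ p∈))) (trans
        (uncut₂ three t v patch (patch-closed kept across)
          (p≢t , λ { refl → ¬kv (inj₂ p∈) }) (c≢t , λ { refl → ¬kv (inj₁ refl) }))
        (patch-in (inj₁ refl)))
        where
        open Patch {G} K? T (T c)
        kept : ∀ {f x y} → Joins G f x y → AllE G f → x ≢ t × x ≢ v → y ≢ t × y ≢ v → K x → K y → T x ≡ T y
        kept {f} j _ (x≢ , _) (y≢ , _) kx ky = closed {f} j tt (kx , x≢) (ky , y≢)
        across : ∀ {f x y} → Joins G f x y → AllE G f → x ≢ t × x ≢ v → y ≢ t × y ≢ v → K x → ¬ K y → T x ≡ T c
        across {f} j _ _ (_ , y≢) kx ¬ky with boundary-end {f} j kx ¬ky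
        ... | inj₁ refl = refl
        ... | inj₂ end = ends end y≢
      same-as-c : c ≢ t → ∀ {p} → C p → p ≢ t → T p ≡ T c
      same-as-c c≢t {p} p∈ p≢t with T u₁ Bool.≟ T c | T u₂ Bool.≟ T c
      ... | yes Tu₁ | _ = removing c≢t v₂∉K
        (λ { (inj₁ (refl , _)) _ → Tu₁ ; (inj₂ (_ , refl)) y≢ → contradiction refl y≢ }) p∈ p≢t
      ... | no _ | yes Tu₂ = removing c≢t v₁∉K
        (λ { (inj₁ (_ , refl)) y≢ → contradiction refl y≢ ; (inj₂ (refl , _)) _ → Tu₂ }) p∈ p≢t
      -- c has a neighbour a ≠ t of its own colour in C, and {t , c} separates a from u₁ and u₂.
      ... | no Tu₁ | no Tu₂ with neighbour-avoiding t | one-differs v₁≢v₂ t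
      ...   | f₀ , a , j₀ , a∈ , a≢t | v≢t = ⊥-elim (clash v≢t)
        where
        open Patch {G} K? T (T u₁)
        kept : ∀ {f x y} → Joins G f x y → AllE G f → x ≢ t × x ≢ c → y ≢ t × y ≢ c → K x → K y → T x ≡ T y
        kept {f} j _ (x≢ , _) (y≢ , _) kx ky = closed {f} j tt (kx , x≢) (ky , y≢)
        across : ∀ {f x y} → Joins G f x y → AllE G f → x ≢ t × x ≢ c → y ≢ t × y ≢ c → K x → ¬ K y → T x ≡ T u₁
        across {f} j _ (_ , x≢c) _ kx ¬ky with boundary-end {f} j kx ¬ky
        ... | inj₁ p = contradiction p x≢c
        ... | inj₂ (inj₁ (refl , _)) = refl
        ... | inj₂ (inj₂ (refl , _)) = two-valued Tu₂ Tu₁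
        a≢c : a ≢ c
        a≢c = ≢-sym (Joins⇒≢ {G} {f₀} j₀)
        clash-with : ∀ {v} → ¬ K v → v ≢ t → v ≢ c → ⊥
        clash-with ¬kv v≢t v≢c = Tu₁ (trans (sym (trans (sym (patch-in (inj₂ (a≢c , a∈)))) (trans
          (uncut₂ three t c patch (patch-closed kept across) (a≢t , a≢c) (v≢t , v≢c))
          (patch-out ¬kv)))) (sym (closed {f₀} j₀ tt (inj₁ refl , c≢t) (inj₂ (a≢c , a∈) , a≢t))))
        clash : v₁ ≢ t ⊎ v₂ ≢ t → ⊥
        clash (inj₁ q) = clash-with v₁∉K q v₁≢c
        clash (inj₂ q) = clash-with v₂∉K q v₂≢c
      cases : Dec (c ≡ t) → ∀ {x y} → K x → x ≢ t → K y → y ≢ t → T x ≡ T y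
      cases (yes refl) (inj₁ p) x≢t _ _ = contradiction p x≢t
      cases (yes refl) _ _ (inj₁ p) y≢t = contradiction p y≢t
      cases (yes refl) (inj₂ x∈) _ (inj₂ y∈) _ =
        uncut-C T (λ {f} j _ p q → closed {f} j tt (inj₂ p , proj₁ p) (inj₂ q , proj₁ q)) x∈ y∈
      cases (no c≢t) (inj₁ refl) _ (inj₁ refl) _ = refl
      cases (no c≢t) (inj₁ refl) _ (inj₂ y∈) y≢t = sym (same-as-c c≢t y∈ y≢t)
      cases (no c≢t) (inj₂ x∈) x≢t (inj₁ refl) _ = same-as-c c≢t x∈ x≢t
      cases (no c≢t) (inj₂ x∈) x≢t (inj₂ y∈) y≢t =
        trans (same-as-c c≢t x∈ x≢t) (sym (same-as-c c≢t y∈ y≢t))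

    side : Side G K (attach u₁ u₂ c)
    side = record
      { K? = K?
      ; attached = λ { zero → inj₂ (u₁≢c , u₁∈) ; (suc zero) → inj₂ (u₂≢c , u₂∈) ; (suc (suc zero)) → inj₁ refl }
      ; distinct = λ {i} {j} → distinct i j
      ; boundary = boundary
      ; uncut-minus = uncut-minus
      ; linked = linked
      ; out₁ = v₁
      ; out₂ = v₂
      ; out₁∉ = v₁∉K
      ; out₂∉ = v₂∉K
      ; out-distinct = v₁≢v₂
      }
      where
      a : Fin 3 → Vtx G
      a = attach u₁ u₂ c
      distinct : ∀ i j → a i ≡ a j → i ≡ j
      distinct zero zero _ = refl
      distinct zero (suc zero) p = contradiction p u₁≢u₂
      distinct zero (suc (suc zero)) p = contradiction p u₁≢c
      distinct (suc zero) zero p = contradiction (sym p) u₁≢u₂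
      distinct (suc zero) (suc zero) _ = refl
      distinct (suc zero) (suc (suc zero)) p = contradiction p u₂≢c
      distinct (suc (suc zero)) zero p = contradiction (sym p) u₁≢c
      distinct (suc (suc zero)) (suc zero) p = contradiction (sym p) u₂≢c
      distinct (suc (suc zero)) (suc (suc zero)) _ = refl
      boundary : ∀ {f x y} → Joins G f x y → K x → ¬ K y → ∃ λ i → a i ≡ x
      boundary {f} j kx ¬ky with boundary-end {f} j kx ¬ky
      ... | inj₁ p = suc (suc zero) , sym p
      ... | inj₂ (inj₁ (p , _)) = zero , sym p
      ... | inj₂ (inj₂ (p , _)) = suc zero , sym p
      -- The opposite component is connected and does not contain `z`. The vertices `u₁` and `u₂`
      -- reach it along `e₁` and `e₂`, and `c` does so through `outer-neighbour`.
      linked : ∀ {z} → K z → ∀ (T : Vtx G → Bool) →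
        (∀ {e u w} → Joins G e u w → ¬ (K u × K w) → u ≢ z → w ≢ z → T u ≡ T w) →
        ∀ i j → a i ≢ z → a j ≢ z → T (a i) ≡ T (a j)
      linked {z} kz T closed i j ai≢z aj≢z = trans (as-v₁ i ai≢z) (sym (as-v₁ j aj≢z))
        where
        ∉⇒≢z : ∀ {x} → ¬ K x → x ≢ z
        ∉⇒≢z ¬kx refl = ¬kx kz
        among : ∀ {x y} → x ≢ c × S x ≢ b → y ≢ c × S y ≢ b → T x ≡ T y
        among = uncut-outside T λ {f} j _ (x≢c , x∉) (y≢c , y∉) →
          closed {f} j (out-∉ x≢c x∉ ∘ proj₁) (∉⇒≢z (out-∉ x≢c x∉)) (∉⇒≢z (out-∉ y≢c y∉))
        across : ∀ {f x y} → Joins G f x y → y ≢ c × S y ≢ b → x ≢ z → T x ≡ T v₁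
        across {f} j (y≢c , y∉) x≢z = trans
          (closed {f} j (out-∉ y≢c y∉ ∘ proj₂) x≢z (∉⇒≢z (out-∉ y≢c y∉)))
          (among (y≢c , y∉) (v₁≢c , v₁∉))
        as-v₁ : ∀ i → a i ≢ z → T (a i) ≡ T v₁
        as-v₁ zero = across {e₁} j₁ (v₁≢c , v₁∉)
        as-v₁ (suc zero) = across {e₂} j₂ (v₂≢c , v₂∉)
        as-v₁ (suc (suc zero)) = let f , d , j , d∉ = outer-neighbour in
          across {f} j (≢-sym (Joins⇒≢ {G} {f} j) , d∉)

-- From 3-edge-cuts to the parts

true⇒ : ∀ {A : Set} (a? : Dec A) → does a? ≡ true → A
true⇒ (yes a) _ = a

false⇒ : ∀ {A : Set} (a? : Dec A) → does a? ≡ false → ¬ A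
false⇒ (no ¬a) _ = ¬a

uncut-resp : ∀ {G KV KV′ KE} → (∀ {v} → KV v → KV′ v) → (∀ {v} → KV′ v → KV v) →
  Uncut G KV KE → Uncut G KV′ KE
uncut-resp to from uncut T closed ku kv = uncut T (λ {f} j ke kx ky → closed {f} j ke (to kx) (to ky)) (from ku) (from kv)

InducedE-Joins : ∀ {G K P f x y} → Joins G f x y → K x → K y → P f → InducedE G K P f
InducedE-Joins (inj₁ (refl , refl)) kx ky pf = kx , ky , pf
InducedE-Joins (inj₂ (refl , refl)) kx ky pf = ky , kx , pf

critical : ∀ {G} → ThreeConnected G → CriticalTwoHalfConnected G → Critical G
critical {G} three (_ , crit) e uncut = crit e (V2EUncut⇒twoHalf G three e uncut)

record Crossing (G : Graph) (S : Vtx G → Bool) (b : Bool) (e : Fin 3 → Edge G) (u v : Fin 3 → Vtx G) : Set where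
  field
    joins : ∀ i → Joins G (e i) (u i) (v i)
    u∈    : ∀ i → S (u i) ≡ b
    v∉    : ∀ i → S (v i) ≢ b
    only  : ∀ {f x y} → Joins G f x y → S x ≡ b → S y ≢ b → ∃ λ i → f ≡ e i

-- Non-degeneracy gives two vertices on the `u` side. On the other side `c` and the end of `e₁` are
-- distinct, because a separator edge misses `c`. This is what distinctness of all ends requires.
crossing-injective : ∀ {G} → ThreeConnected G → Critical G → ∀ {c S b e u v} →
  Separates G c (e (suc zero)) (e (suc (suc zero))) → ¬ Degenerate G c (e (suc zero)) (e (suc (suc zero))) →
  Crossing G S b e u v → Crossing G S (not b) e v u → v zero ≡ c →
  (∀ {i j} → u i ≡ u j → i ≡ j) × (∀ {i j} → v i ≡ v j → i ≡ j)
crossing-injective {G} three crit {c} {S} {b} {e} {u} {v} sep ¬deg X Y refl =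
    ThreeEdgeCut.ends-distinct three S b e u v X.joins X.u∈ X.v∉ (λ {f} → X.only {f})
      (X.u∈ (suc zero)) (X.u∈ (suc (suc zero))) u₁≢u₂ (X.v∉ zero) (X.v∉ (suc zero)) c≢v₁
  , ThreeEdgeCut.ends-distinct three S (not b) e v u Y.joins Y.u∈ Y.v∉ (λ {f} → Y.only {f})
      (Y.u∈ zero) (Y.u∈ (suc zero)) c≢v₁ (Y.v∉ (suc zero)) (Y.v∉ (suc (suc zero))) u₁≢u₂
  where
  module X = Crossing X
  module Y = Crossing Y
  -- The cut edge with index zero ends in `c`, so away from `c` only the other two cross.
  only′ : ∀ {f x y} → Joins G f x y → x ≢ c → y ≢ c → S x ≡ b → S y ≢ b →
    f ≡ e (suc zero) ⊎ f ≡ e (suc (suc zero))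
  only′ {f} j x≢c y≢c x∈ y∉ with X.only {f} j x∈ y∉
  ... | suc zero , p = inj₁ p
  ... | suc (suc zero) , p = inj₂ p
  ... | zero , refl with Joins-unique {G} j (X.joins zero)
  ... | inj₁ (_ , q) = contradiction q y≢c
  ... | inj₂ (q , _) = contradiction q x≢c
  open CutVertex three crit sep S b (λ {f} → only′ {f}) (X.joins (suc zero)) (X.joins (suc (suc zero)))
    (X.u∈ (suc zero)) (X.u∈ (suc (suc zero))) (X.v∉ (suc zero)) (X.v∉ (suc (suc zero)))
  u₁≢u₂ : u (suc zero) ≢ u (suc (suc zero))
  u₁≢u₂ = ends-distinct ¬deg
  c≢v₁ : v zero ≢ v (suc zero)
  c≢v₁ = ≢-sym v₁≢c

crossing-goodPart : ∀ {G} → ThreeConnected G → Critical G → ∀ {S b e u v P H} →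
  Crossing G S b e u v → (∀ {i j} → u i ≡ u j → i ≡ j) → (∀ {i j} → v i ≡ v j → i ≡ j) →
  Uncut G (λ w → S w ≢ b) (AllE G) → (∀ {f} → (∀ i → f ≢ e i) → P f) →
  IsAttachGraph G (λ w → S w ≡ b) (InducedE G (λ w → S w ≡ b) P) u H → GoodPart G H
crossing-goodPart {G} three crit {S} {b} {e} {u} {v} {P} X u-inj v-inj uncut-out rest =
  Attach.goodPart three crit
    (ThreeEdgeCut.side three S b e u v X.joins X.u∈ X.v∉ (λ {f} → X.only {f}) u-inj v-inj uncut-out)
    λ {f} j x∈ y∈ → InducedE-Joins {G} {λ w → S w ≡ b} {P} j x∈ y∈ (rest λ { i refl → not-crossing i j x∈ y∈ })
  where
  module X = Crossing X
  -- Cut edges have ends on both sides, so every edge inside one side is kept.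
  not-crossing : ∀ i {x y} → Joins G (e i) x y → S x ≡ b → S y ≡ b → ⊥
  not-crossing i j x∈ y∈ with Joins-unique {G} j (X.joins i)
  ... | inj₁ (refl , refl) = X.v∉ i y∈
  ... | inj₂ (refl , refl) = X.v∉ i x∈

-- Exactly two components

module CutComponents {G : Graph} (three : ThreeConnected G) {c : Vtx G} {e₁ e₂ : Edge G}
  (sep : Separates G c e₁ e₂) where

  Kept : Edge G → Set
  Kept f = f ≢ e₁ × f ≢ e₂

  c? : Decidable (_≢ c)
  c? v = ¬? (v ≟ c)

  Kept? : Decidable Kept
  Kept? f = ¬? (f ≟ e₁) ×-dec ¬? (f ≟ e₂)

  open Labelling (labelling {G} c? Kept?)

  p q : Vtx G
  p = proj₁ (ends G e₁)
  q = proj₂ (ends G e₁)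

  p≢c : p ≢ c
  p≢c r = separator-edge∌ three sep (inj₁ r)
  q≢c : q ≢ c
  q≢c r = separator-edge∌ three sep (inj₂ r)

  label-closed : ∀ {f x y} → Joins G f x y → Kept f → x ≢ c → y ≢ c → label x ≡ label y
  label-closed {f} = along (∈-allFin f)

  same⇒walk : ∀ {x y} → x ≢ c → y ≢ c → label x ≡ label y → Walk G (_≢ c) Kept x y
  same⇒walk = same-label⇒walk c? Kept?

  -- e₁ is a bridge of the connected graph G - c - e₂.
  two-labels : ∀ {v} → v ≢ c → label v ≡ label p ⊎ label v ≡ label q
  two-labels {v} v≢c = true⇒ (test v)
    (trans (uncut₁₁ three c e₂ (does ∘ test) closed v≢c p≢c) (dec-true (test p) (inj₁ refl)))
    where
    test : ∀ v → Dec (label v ≡ label p ⊎ label v ≡ label q)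
    test v = (label v ≟ label p) ⊎-dec (label v ≟ label q)
    closed : Closed G (_≢ c) (_≢ e₂) (does ∘ test)
    closed {f} {x} {y} j f≢e₂ x≢c y≢c with f ≟ e₁
    ... | no f≢e₁ = cong (λ l → does ((l ≟ label p) ⊎-dec (l ≟ label q))) (label-closed {f} j (f≢e₁ , f≢e₂) x≢c y≢c)
    ... | yes refl with j
    ... | inj₁ (refl , refl) = trans (dec-true (test p) (inj₁ refl)) (sym (dec-true (test q) (inj₂ refl)))
    ... | inj₂ (refl , refl) = trans (dec-true (test q) (inj₂ refl)) (sym (dec-true (test p) (inj₁ refl)))

  -- A label common to both ends of `e₁` would by `two-labels` be the only one, and nothing would be
  -- separated.
  labels-distinct : label q ≢ label p
  labels-distinct eq = sep (connected⇒uncut λ u v u≢c v≢c → same⇒walk u≢c v≢c (trans (all u≢c) (sym (all v≢c))))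
    where
    all : ∀ {v} → v ≢ c → label v ≡ label p
    all v≢c with two-labels v≢c
    ... | inj₁ r = r
    ... | inj₂ r = trans r eq

  S : Vtx G → Bool
  S v = does (label v ≟ label p)

  S-walk : ∀ {u v} → Walk G (_≢ c) Kept u v → S u ≡ S v
  S-walk r = cong (λ l → does (l ≟ label p)) (walk-invariant label (λ {f} → label-closed {f}) r)

  at-q : ∀ {v} → v ≢ c → S v ≡ false → label v ≡ label q
  at-q {v} v≢c r with two-labels v≢c
  ... | inj₁ s = contradiction s (false⇒ (label v ≟ label p) r)
  ... | inj₂ s = s

  component : ∀ {b x} → x ≢ c → S x ≡ b → (∀ {v} → v ≢ c → S v ≡ b → label v ≡ label x) →
    IsComponent G (_≢ c) Kept (λ v → v ≢ c × S v ≡ b)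
  component x≢c x∈ to-x =
      (_ , x≢c , x∈)
    , (λ _ → proj₁)
    , (λ u v (u≢c , u∈) (v≢c , v∈) → same⇒walk u≢c v≢c (trans (to-x u≢c u∈) (sym (to-x v≢c v∈))))
    , (λ u v (_ , u∈) r → start (reverse r) , trans (sym (S-walk r)) u∈)

  covered : ∀ v → v ≢ c → (v ≢ c × S v ≡ true) ⊎ (v ≢ c × S v ≡ false)
  covered v v≢c with S v
  ... | true = inj₁ (v≢c , refl)
  ... | false = inj₂ (v≢c , refl)

  two-components : TwoComponents G (_≢ c) Kept (λ v → v ≢ c × S v ≡ true) (λ v → v ≢ c × S v ≡ false)
  two-components =
      component p≢c (dec-true (label p ≟ label p) refl) (λ {v} _ → true⇒ (label v ≟ label p))
    , component q≢c (dec-false (label q ≟ label p) labels-distinct) at-q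
    , covered

≡not⇒≢ : ∀ {x b : Bool} → x ≡ not b → x ≢ b
≡not⇒≢ refl eq = Bool.not-¬ refl (sym eq)

-- Case (b): splitting at the vertex

module PartB {G : Graph} (three : ThreeConnected G) (crit : Critical G)
  {c : Vtx G} {e₁ e₂ : Edge G} (sep : Separates G c e₁ e₂) (¬deg : ¬ Degenerate G c e₁ e₂)
  (not-cut : ∀ e₀ → IsEnd G e₀ c → ¬ ¬ Connected G (AllV G) (λ f → f ≢ e₀ × f ≢ e₁ × f ≢ e₂))
  (S : Vtx G → Bool)
  where

  Kept : Edge G → Set
  Kept f = f ≢ e₁ × f ≢ e₂

  Comp : Bool → Set
  Comp b = IsComponent G (_≢ c) Kept (λ v → v ≢ c × S v ≡ b)

  crossing : ∀ {b} → Comp b → ∀ {f x y} → Joins G f x y → x ≢ c → y ≢ c → S x ≡ b → S y ≢ b → f ≡ e₁ ⊎ f ≡ e₂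
  crossing comp {f} j x≢c y≢c x∈ y∉ with f ≟ e₁ | f ≟ e₂
  ... | yes p | _ = inj₁ p
  ... | _ | yes p = inj₂ p
  ... | no ¬p | no ¬q = contradiction (proj₂ (component-step comp {f} j (¬p , ¬q) (x≢c , x∈) y≢c)) y∉

  goodPart : ∀ b → Comp b → Comp (not b) → ∀ {u₁ u₂ v₁ v₂ H} → Joins G e₁ u₁ v₁ → Joins G e₂ u₂ v₂ →
    S u₁ ≡ b → S u₂ ≡ b → S v₁ ≡ not b → S v₂ ≡ not b →
    IsAttachGraph G (λ v → v ≡ c ⊎ (v ≢ c × S v ≡ b))
      (InducedE G (λ v → v ≡ c ⊎ (v ≢ c × S v ≡ b)) (AllE G)) (attach u₁ u₂ c) H →
    GoodPart G H
  goodPart b comp comp′ {u₁} {u₂} {v₁} {v₂} j₁ j₂ u₁∈ u₂∈ v₁∈ v₂∈ =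
    Attach.goodPart three crit (Side-b.side v₁≢v₂ (component-uncut comp)
      (uncut-resp {G} {λ w → w ≢ c × S w ≡ not b} {λ w → w ≢ c × S w ≢ b} {AllE G}
        (λ (p , q) → p , ≡not⇒≢ q) (λ (p , q) → p , Bool.¬-not q) (component-uncut comp′))
      -- The neighbour of `c` beyond the cut comes from the same argument with the sides exchanged.
      (let f , d , j , d∈ = Side-¬b.neighbour in f , d , j , ≡not⇒≢ d∈))
      λ {f} j x∈ y∈ → InducedE-Joins {G} {λ v → v ≡ c ⊎ (v ≢ c × S v ≡ b)} {AllE G} {f} j x∈ y∈ tt
    where
    not-in : ∀ {u} → S u ≡ b → S u ≢ not b
    not-in = Bool.not-¬
    module Cut-b = CutVertex three crit sep S b (λ {f} → crossing comp {f}) j₁ j₂ u₁∈ u₂∈ (≡not⇒≢ v₁∈) (≡not⇒≢ v₂∈)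
    module Cut-¬b = CutVertex three crit sep S (not b) (λ {f} → crossing comp′ {f})
      (Joins-sym {G} j₁) (Joins-sym {G} j₂) v₁∈ v₂∈ (not-in u₁∈) (not-in u₂∈)
    v₁≢v₂ : v₁ ≢ v₂
    v₁≢v₂ = Cut-¬b.ends-distinct ¬deg
    module Side-b = CutVertexSide three crit sep not-cut S b (λ {f} → crossing comp {f})
      j₁ j₂ u₁∈ u₂∈ (≡not⇒≢ v₁∈) (≡not⇒≢ v₂∈) (Cut-b.ends-distinct ¬deg)
    module Side-¬b = CutVertexSide three crit sep not-cut S (not b) (λ {f} → crossing comp′ {f})
      (Joins-sym {G} j₁) (Joins-sym {G} j₂) v₁∈ v₂∈ (not-in u₁∈) (not-in u₂∈) v₁≢v₂

-- Case (a): splitting along the 3-edge-cut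

module PartA {G : Graph} {e₀ e₁ e₂ : Edge G} (S : Vtx G → Bool) where

  Kept : Edge G → Set
  Kept f = f ≢ e₀ × f ≢ e₁ × f ≢ e₂

  Comp : Bool → Set
  Comp b = IsComponent G (AllV G) Kept (λ v → S v ≡ b)

  e : Fin 3 → Edge G
  e = attach e₀ e₁ e₂

  kept : ∀ {f} → (∀ i → f ≢ e i) → Kept f
  kept h = h zero , h (suc zero) , h (suc (suc zero))

  -- A component is closed under kept edges, so an edge leaving it is one of the three deleted ones.
  only : ∀ {b} → Comp b → ∀ {f x y} → Joins G f x y → S x ≡ b → S y ≢ b → ∃ λ i → f ≡ e i
  only comp {f} j x∈ y∉ = decidable-stable (any? λ i → f ≟ e i) λ none →
    y∉ (component-step comp {f} j (kept λ i p → none (i , p)) x∈ tt)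

  crossing : ∀ b → Comp b → ∀ {u v} → (∀ i → IsEnd G (e i) (u i)) → (∀ i → S (u i) ≡ b) →
    (∀ i → IsEnd G (e i) (v i)) → (∀ i → S (v i) ≡ not b) → Crossing G S b e u v
  crossing b comp u-end u∈ v-end v∈ = record
    { joins = λ i → IsEnd⇒Joins {G} {e i} (λ p → ≡not⇒≢ (v∈ i) (trans (cong S (sym p)) (u∈ i))) (u-end i) (v-end i)
    ; u∈ = u∈
    ; v∉ = λ i → ≡not⇒≢ (v∈ i)
    ; only = λ {f} → only comp {f}
    }

  uncut-outside : ∀ b → Comp (not b) → Uncut G (λ w → S w ≢ b) (AllE G)
  uncut-outside b comp = uncut-resp {G} {λ w → S w ≡ not b} {λ w → S w ≢ b} {AllE G} ≡not⇒≢ Bool.¬-not (component-uncut comp)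

attach-elim : {P : Fin 3 → Set} → P zero → P (suc zero) → P (suc (suc zero)) → ∀ i → P i
attach-elim x y z zero = x
attach-elim x y z (suc zero) = y
attach-elim x y z (suc (suc zero)) = z

theorem7 : (G : Graph) (c : Vtx G) (e₁ e₂ : Edge G) →
  ThreeConnected G → NonDegenerateV2ESep G c e₁ e₂ →
  CriticalTwoHalfConnected G →
  -- (a)
  ((e₀ : Edge G) → IsEnd G e₀ c →
    ¬ Connected G (AllV G) (λ f → f ≢ e₀ × f ≢ e₁ × f ≢ e₂) →
    (S : Vtx G → Bool) →
    TwoComponents G (AllV G) (λ f → f ≢ e₀ × f ≢ e₁ × f ≢ e₂)
      (λ v → S v ≡ true) (λ v → S v ≡ false) →
    (u₀ u₁ u₂ v₀ v₁ v₂ : Vtx G) →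
    IsEnd G e₀ u₀ → S u₀ ≡ true → IsEnd G e₁ u₁ → S u₁ ≡ true →
    IsEnd G e₂ u₂ → S u₂ ≡ true →
    IsEnd G e₀ v₀ → S v₀ ≡ false → IsEnd G e₁ v₁ → S v₁ ≡ false →
    IsEnd G e₂ v₂ → S v₂ ≡ false →
    (G₁ G₂ : Graph) →
    IsAttachGraph G (λ v → S v ≡ true)
      (InducedE G (λ v → S v ≡ true) (λ f → f ≢ e₀ × f ≢ e₁ × f ≢ e₂))
      (attach u₀ u₁ u₂) G₁ →
    IsAttachGraph G (λ v → S v ≡ false)
      (InducedE G (λ v → S v ≡ false) (λ f → f ≢ e₀ × f ≢ e₁ × f ≢ e₂))
      (attach v₀ v₁ v₂) G₂ →
    GoodPart G G₁ × GoodPart G G₂)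
  ×
  -- (b)
  ((¬ ∃ λ (e₀ : Edge G) → IsEnd G e₀ c ×
       ¬ Connected G (AllV G) (λ f → f ≢ e₀ × f ≢ e₁ × f ≢ e₂)) →
    (∃ λ (S : Vtx G → Bool) → TwoComponents G (λ v → v ≢ c) (λ f → f ≢ e₁ × f ≢ e₂)
       (λ v → v ≢ c × S v ≡ true) (λ v → v ≢ c × S v ≡ false)) ×
    ((S : Vtx G → Bool) →
     TwoComponents G (λ v → v ≢ c) (λ f → f ≢ e₁ × f ≢ e₂)
       (λ v → v ≢ c × S v ≡ true) (λ v → v ≢ c × S v ≡ false) →
     (u₁ u₂ v₁ v₂ : Vtx G) →
     IsEnd G e₁ u₁ → u₁ ≢ c → S u₁ ≡ true →
     IsEnd G e₂ u₂ → u₂ ≢ c → S u₂ ≡ true →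
     IsEnd G e₁ v₁ → v₁ ≢ c → S v₁ ≡ false →
     IsEnd G e₂ v₂ → v₂ ≢ c → S v₂ ≡ false →
     (G₁ G₂ : Graph) →
     IsAttachGraph G (λ v → v ≡ c ⊎ (v ≢ c × S v ≡ true))
       (InducedE G (λ v → v ≡ c ⊎ (v ≢ c × S v ≡ true)) (AllE G))
       (attach u₁ u₂ c) G₁ →
     IsAttachGraph G (λ v → v ≡ c ⊎ (v ≢ c × S v ≡ false))
       (InducedE G (λ v → v ≡ c ⊎ (v ≢ c × S v ≡ false)) (AllE G))
       (attach v₁ v₂ c) G₂ →
     GoodPart G G₁ × GoodPart G G₂))
theorem7 G c e₁ e₂ three ((_ , ¬conn) , ¬deg) crit = part-a , part-b
  where
  crit′ : Critical G
  crit′ = critical three crit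
  sep : Separates G c e₁ e₂
  sep = separates ¬conn

  part-a : _
  part-a e₀ e₀∋c _ S (comp₁ , comp₂ , _) u₀ u₁ u₂ v₀ v₁ v₂ u₀-end u₀∈ u₁-end u₁∈ u₂-end u₂∈
    v₀-end v₀∈ v₁-end v₁∈ v₂-end v₂∈ G₁ G₂ attach₁ attach₂ =
      crossing-goodPart three crit′ X u-inj v-inj (uncut-outside true comp₂) kept attach₁
    , crossing-goodPart three crit′ Y v-inj u-inj (uncut-outside false comp₁) kept attach₂
    where
    open PartA {G} {e₀} {e₁} {e₂} S
    u v : Fin 3 → Vtx G
    u = attach u₀ u₁ u₂
    v = attach v₀ v₁ v₂
    X : Crossing G S true e u v
    X = crossing true comp₁ (attach-elim u₀-end u₁-end u₂-end) (attach-elim u₀∈ u₁∈ u₂∈) (attach-elim v₀-end v₁-end v₂-end) (attach-elim v₀∈ v₁∈ v₂∈)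
    Y : Crossing G S false e v u
    Y = crossing false comp₂ (attach-elim v₀-end v₁-end v₂-end) (attach-elim v₀∈ v₁∈ v₂∈) (attach-elim u₀-end u₁-end u₂-end) (attach-elim u₀∈ u₁∈ u₂∈)
    injective : (∀ {i j} → u i ≡ u j → i ≡ j) × (∀ {i j} → v i ≡ v j → i ≡ j)
    -- `c` is an end of `e₀` and may lie on either side; `crossing-injective` expects it among the
    -- `v i`, so the sides are exchanged when it is `u₀`.
    injective with IsEnd-Joins {G} {e₀} e₀∋c (Crossing.joins X zero)
    ... | inj₁ p = let v-inj , u-inj = crossing-injective three crit′ sep ¬deg Y X p in u-inj , v-inj
    ... | inj₂ p = crossing-injective three crit′ sep ¬deg X Y p
    u-inj : ∀ {i j} → u i ≡ u j → i ≡ j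
    u-inj = proj₁ injective
    v-inj : ∀ {i j} → v i ≡ v j → i ≡ j
    v-inj = proj₂ injective

  part-b : _
  part-b ¬cut = (CutComponents.S three sep , CutComponents.two-components three sep) ,
    λ S (comp₁ , comp₂ , _) u₁ u₂ v₁ v₂ u₁-end _ u₁∈ u₂-end _ u₂∈ v₁-end _ v₁∈ v₂-end _ v₂∈ G₁ G₂ attach₁ attach₂ →
      let open PartB three crit′ sep ¬deg (λ e₀ e₀∋c ¬conn → ¬cut (e₀ , e₀∋c , ¬conn)) S
          j₁ = IsEnd⇒Joins {G} {e₁} (λ p → ≡not⇒≢ v₁∈ (trans (cong S (sym p)) u₁∈)) u₁-end v₁-end
          j₂ = IsEnd⇒Joins {G} {e₂} (λ p → ≡not⇒≢ v₂∈ (trans (cong S (sym p)) u₂∈)) u₂-end v₂-end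
      in goodPart true comp₁ comp₂ j₁ j₂ u₁∈ u₂∈ v₁∈ v₂∈ attach₁
       , goodPart false comp₂ comp₁ (Joins-sym {G} j₁) (Joins-sym {G} j₂) v₁∈ v₂∈ u₁∈ u₂∈ attach₂
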